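{- Let $L$ be the logic MSO or GSO. For every $\tau$-formula $\Phi\in L_{k,q}[\tau]$ and every width $w$, there is a first-order $\tau^{L}_{k,q}$-formula $\alpha_{\Phi,w}$ without free variables such that the following holds: For every rooted partition $F=(\mathcal{S}_i)_{i\in I}$ of a width-$w$ rooted $\tau$-structure $\mathcal{S}$ and every guarded variable assignment $a$ we have $$\mathcal{I}^{L}_{k,q}(F,a)\models\alpha_{\Phi,w}\quad\text{if, and only if,}\quad(\mathcal{S},a)\models\Phi .$$
   Context: **Structures.** $\tau$ is an arbitrary vocabulary; all vocabularies are finite and purely relational. A structure $\mathcal{S}$ over $\tau$ has universe $S$ and a relation $R^{\mathcal{S}}\subseteq S^r$ for each $r$-ary $R\in\tau$. $\mathcal{S}$ is an induced substructure of $\mathcal{S}'$ if $S\subseteq S'$ and $R^{\mathcal{S}}=R^{\mathcal{S}'}\cap S^r$ for all $r$-ary $R\in\tau$. The union of structures is formed by taking the union of the universes and of each relation. The Gaifman graph of a relation $R\subseteq S^r$ is the undirected graph on $S$ in which two distinct elements are adjacent iff they occur in a common tuple of $R$; the Gaifman graph of $\mathcal{S}$ is the union of those of its relations; a relation $R$ on $S$ is guarded in $\mathcal{S}$ if its Gaifman graph is a subgraph of that of $\mathcal{S}$. **Second-order formulas.** Second-order formulas are taken to contain no first-order variables. Each second-order variable $X$ has an arity $r(X)$. The atomic formulas are $\mathrm{empty}(X)$ for monadic (i.e. arity-1) $X$ (true iff $a(X)=\emptyset$) and $\mathrm{elem}(Y_1,\dots,Y_r,Z)$, where the $Y_i$ are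 monadic second-order variables and $Z$ is an $r$-ary relation symbol of $\tau$ or an $r$-ary second-order variable (true iff $|a(Y_i)|=1$ for all $i$ and $a(Y_1)\times\dots\times a(Y_r)$ is contained in $Z^{\mathcal{S}}$, respectively in $a(Z)$). In these atoms, monadic relation symbols of $\tau$ may also be used in place of the monadic variables, with the obvious meaning. Formulas are built from atoms with $\neg$, $\wedge$ and $\exists X$. In MSO (monadic second-order logic) all second-order variables are monadic; in GSO (guarded second-order logic) variables of any arity may occur, but bound and free variables may only be assigned relations guarded in the structure. A variable assignment is guarded if all its values are guarded relations. **Types.** $k$ and $q$ are arbitrary natural numbers. $L_{k,q}[\tau]$ is the set of $L$-formulas over $\tau$ whose free variables lie in $\{X_1,\dots,X_k\}$ and whose quantifier rank (nesting depth of quantifiers) is at most $q$; the assignments $a$ considered have domain $\{X_1,\dots,X_k\}$. The $k$-variable rank-$q$ $L$-type $\mathrm{type}^{L}_{k,q}(\mathcal{S},a)$ of a structure $\mathcal{S}$ with guarded assignment $a$ is the set of all $\Phi\in L_{k,q}[\tau]$ with $(\mathcal{S},a)\models\Phi$. $\Sigma^{L}_{k,q}$ is the set of all these types (over $\tau$). As a known fact, $L_{k,q}[\tau]$ contains only finitely many formulas up to logical equivalence, so $\Sigma^{L}_{k,q}$ is treated as a finite alphabet. $\tau^{L}_{k,q}$ is the vocabulary with one monadic relation symbol $T$ for each $T\in\Sigma^{L}_{k,q}$. **Type indicators.** For a family $F=(\mathcal{S}_i)_{i\in I}$ of $\tau$-structures (the index set $I$ is not necessarily finite) and a map $a$ assigning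 to each $X\in\{X_1,\dots,X_k\}$ a relation $a(X)\subseteq(\bigcup_{i\in I}S_i)^{r(X)}$, put $a_i(X)=a(X)\cap S_i^{r(X)}$. The $L$-type indicator $\mathcal{I}^{L}_{k,q}(F,a)$ is the $\tau^{L}_{k,q}$-structure with universe $I$ in which each $T\in\Sigma^{L}_{k,q}$ is interpreted as $\{i\in I\mid T=\mathrm{type}^{L}_{k,q}(\mathcal{S}_i,a_i)\}$. **Rooted structures and partitions.** For a width $w\ge 0$, a width-$w$ rooted structure is a structure $\mathcal{S}$ over a vocabulary $\tau$ containing special monadic relation symbols $B_1,\dots,B_w$ such that each $B_\ell^{\mathcal{S}}$ is a singleton; its bag is $B(\mathcal{S})=\bigcup_{\ell=1}^{w}B_\ell^{\mathcal{S}}$. A rooted partition of $\mathcal{S}$ is a family $(\mathcal{S}_i)_{i\in I}$ of $\tau$-structures such that (a) the union of all $\mathcal{S}_i$ is exactly $\mathcal{S}$; (b) each $\mathcal{S}_i$ is an induced substructure of $\mathcal{S}$; (c) $S_i\cap S_j=B(\mathcal{S})$ for all distinct $i,j\in I$.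
   Formalization: Second-order variables have positive arity; for GSO their arities are bounded by an arbitrary fixed m, and each restriction to a part of a relation guarded in the whole structure is assumed guarded in that part (automatic for MSO or arities of τ at most 2). Without these the claim fails. -}

module Defs where

open import Data.Empty using (⊥-elim)
open import Data.Fin.Base using (Fin)
open import Data.List.Base using (List)
import Data.List.Membership.Propositional as ListMem
open import Data.Nat.Base using (ℕ; suc; _≤_; _⊔_; s≤s)
open import Data.Product.Base using (∃-syntax; Σ-syntax; _×_; _,_; proj₂)
open import Data.Vec.Base using (Vec; []; _∷_; lookup)
open import Data.Vec.Membership.Propositional using (_∈_)
open import Data.Vec.Relation.Unary.All as All using (All; []; _∷_)
open import Data.Vec.Relation.Unary.Any using (here; there)
open import Data.Vec.Relation.Binary.Pointwise.Inductive using (Pointwise)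
open import Function.Bundles using (_↣_; Injection)
open import Level using (Lift; 0ℓ) renaming (suc to lsuc)
open import Relation.Binary.Core using (Rel; _⇒_)
open import Relation.Binary.PropositionalEquality using (_≡_; _≢_; refl; sym; trans)
open import Relation.Nullary.Negation.Core using (¬_)
open import Relation.Unary using (Pred; _⊆_; _≐_; _∩_; ｛_｝; ⋃)

------------------------------------------------------------------------
-- Structures

-- A finite relational vocabulary is the list of the arities of its
-- symbols; an r-ary symbol of τ is a position of r in τ.

Vocabulary : Set
Vocabulary = List ℕ

Symbol : Vocabulary → ℕ → Set
Symbol τ r = r ListMem.∈ τ

Relation : Set → ℕ → Set₁
Relation V r = Pred (Vec V r) 0ℓ

-- The universe is a subset of an ambient type V, so that members of a
-- family of structures can overlap and unions and intersections of
-- universes are literal.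

record Structure (τ : Vocabulary) (V : Set) : Set₁ where
  field
    universe : Pred V 0ℓ
    rel      : ∀ {r} → Symbol τ r → Relation V r
    rel⊆     : ∀ {r} (Z : Symbol τ r) → rel Z ⊆ All universe

open Structure public

private
  variable
    τ   : Vocabulary
    V I : Set

gaifmanRel : ∀ {r} → Relation V r → Rel V 0ℓ
gaifmanRel R x y = x ≢ y × ∃[ v ] (R v × x ∈ v × y ∈ v)

module _ {τ : Vocabulary} {V : Set} where

  infix 4 _≈_

  _≈_ : Structure τ V → Structure τ V → Set
  S ≈ S′ = (universe S ≐ universe S′) ×
           (∀ {r} (Z : Symbol τ r) → rel S Z ≐ rel S′ Z)

  -- Restriction of a relation to the universe of a structure.

  infixl 7 _↾_

  _↾_ : ∀ {r} → Relation V r → Structure τ V → Relation V r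
  R ↾ S = R ∩ All (universe S)

  InducedSubstructure : Structure τ V → Structure τ V → Set
  InducedSubstructure S S′ =
    (universe S ⊆ universe S′) ×
    (∀ {r} (Z : Symbol τ r) → rel S Z ≐ rel S′ Z ↾ S)

  union : {I : Set} → (I → Structure τ V) → Structure τ V
  union {I} F = record
    { universe = ⋃ I (λ i → universe (F i))
    ; rel      = λ Z → ⋃ I (λ i → rel (F i) Z)
    ; rel⊆     = λ { Z (i , p) → All.map (i ,_) (rel⊆ (F i) Z p) }
    }

  gaifman : Structure τ V → Rel V 0ℓ
  gaifman S x y = ∃[ r ] Σ[ Z ∈ Symbol τ r ] gaifmanRel (rel S Z) x y

  Guarded : ∀ {r} → Structure τ V → Relation V r → Set
  Guarded S R = (R ⊆ All (universe S)) × (gaifmanRel R ⇒ gaifman S)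

------------------------------------------------------------------------
-- Second-order formulas

-- GSO is indexed by an upper bound m on the arities of second-order
-- variables.  Every single formula lives in GSO m for some m.  Without a
-- bound there are infinitely many inequivalent formulas of a fixed
-- quantifier rank: one quantified relation of large arity simulates
-- arbitrarily many binary ones, by repeating arguments of elem.

data Logic : Set where
  MSO : Logic
  GSO : (m : ℕ) → Logic

-- Variables have positive arity.

VarArity : Logic → ℕ → Set
VarArity MSO     r = r ≡ 1
VarArity (GSO m) r = (1 ≤ r) × (r ≤ m)

-- The free variables X₁,…,X_k are given by the vector Γ of their
-- arities; variables are de Bruijn indices.

data RelTerm (τ : Vocabulary) {k : ℕ} (Γ : Vec ℕ k) (r : ℕ) : Set where
  con : Symbol τ r → RelTerm τ Γ r
  var : r ∈ Γ      → RelTerm τ Γ r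

infixr 6 _∧′_
infix  7 ¬′_

data Formula (L : Logic) (τ : Vocabulary) {k : ℕ} (Γ : Vec ℕ k) : Set where
  empty : RelTerm τ Γ 1 → Formula L τ Γ
  elem  : ∀ {r} → Vec (RelTerm τ Γ 1) r → RelTerm τ Γ r → Formula L τ Γ
  ¬′_   : Formula L τ Γ → Formula L τ Γ
  _∧′_  : Formula L τ Γ → Formula L τ Γ → Formula L τ Γ
  ∃′    : ∀ r → VarArity L r → Formula L τ (r ∷ Γ) → Formula L τ Γ

rank : ∀ {L k} {Γ : Vec ℕ k} → Formula L τ Γ → ℕ
rank (empty _)  = 0
rank (elem _ _) = 0
rank (¬′ Φ)     = rank Φ
rank (Φ ∧′ Ψ)   = rank Φ ⊔ rank Ψ
rank (∃′ _ _ Φ) = suc (rank Φ)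

Assignment : Set → ∀ {k} → Vec ℕ k → Set₁
Assignment V Γ = All (Relation V) Γ

Singleton : Pred V 0ℓ → Set
Singleton P = ∃[ x ] (P ≐ ｛ x ｝)

asSet : Relation V 1 → Pred V 0ℓ
asSet R x = R (x ∷ [])

module _ {τ : Vocabulary} {V : Set} where

  GuardedAssignment : ∀ {k} {Γ : Vec ℕ k} → Structure τ V → Assignment V Γ → Set
  GuardedAssignment {Γ = Γ} S a = ∀ {r} (X : r ∈ Γ) → Guarded S (All.lookup a X)

  ⟦_⟧ : ∀ {k r} {Γ : Vec ℕ k} → RelTerm τ Γ r → Structure τ V → Assignment V Γ → Relation V r
  ⟦ con Z ⟧ S a = rel S Z
  ⟦ var X ⟧ S a = All.lookup a X

  infix 4 _,_⊨_

  -- In MSO the guardedness requirement only says that the value of the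
  -- variable is a subset of the universe: a monadic relation has an
  -- edgeless Gaifman graph.

  _,_⊨_ : ∀ {L k} {Γ : Vec ℕ k} → Structure τ V → Assignment V Γ → Formula L τ Γ → Set₁
  S , a ⊨ empty X   = Lift (lsuc 0ℓ) (∀ x → ¬ asSet (⟦ X ⟧ S a) x)
  S , a ⊨ elem Ys Z = Lift (lsuc 0ℓ)
    ( (∀ j → Singleton (asSet (⟦ lookup Ys j ⟧ S a)))
    × (∀ v → Pointwise (λ Y x → asSet (⟦ Y ⟧ S a) x) Ys v → ⟦ Z ⟧ S a v) )
  S , a ⊨ ¬′ Φ      = ¬ (S , a ⊨ Φ)
  S , a ⊨ Φ ∧′ Ψ    = (S , a ⊨ Φ) × (S , a ⊨ Ψ)
  S , a ⊨ ∃′ r _ Φ  = Σ[ R ∈ Relation V r ] (Guarded S R × (S , (R ∷ a) ⊨ Φ))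

------------------------------------------------------------------------
-- Types

type : ∀ L {k} {Γ : Vec ℕ k} (q : ℕ) → Structure τ V → Assignment V Γ →
       Pred (Formula L τ Γ) (lsuc 0ℓ)
type L q S a Φ = rank Φ ≤ q × (S , a ⊨ Φ)

-- The alphabet Σ of k-variable rank-q types.  Sets of formulas are
-- compared by _≐_ throughout.

record Type (L : Logic) (τ : Vocabulary) {k : ℕ} (Γ : Vec ℕ k) (q : ℕ) : Set₂ where
  field
    formulas : Pred (Formula L τ Γ) (lsuc 0ℓ)
    realised : ∃[ V ] Σ[ S ∈ Structure τ V ] Σ[ a ∈ Assignment V Γ ]
                 (GuardedAssignment S a × formulas ≐ type L q S a)

open Type public

------------------------------------------------------------------------
-- First-order logic with equality over a monadic vocabulary

-- P is the set of monadic symbols and n the number of free variables.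

data FO {p} (P : Set p) (n : ℕ) : Set p where
  pred : P → Fin n → FO P n
  _≐′_ : Fin n → Fin n → FO P n
  ¬′_  : FO P n → FO P n
  _∧′_ : FO P n → FO P n → FO P n
  ∃′   : FO P (suc n) → FO P n

MonadicStructure : ∀ {p} → Set p → Set → Set _
MonadicStructure P I = P → Pred I (lsuc 0ℓ)

infix 4 _,_⊨ᶠ_ _⊨ᶠ_

_,_⊨ᶠ_ : ∀ {p} {P : Set p} {n} → MonadicStructure P I → Vec I n → FO P n → Set₁
M , e ⊨ᶠ pred T x = M T (lookup e x)
M , e ⊨ᶠ x ≐′ y   = Lift (lsuc 0ℓ) (lookup e x ≡ lookup e y)
M , e ⊨ᶠ ¬′ α     = ¬ (M , e ⊨ᶠ α)
M , e ⊨ᶠ α ∧′ β   = (M , e ⊨ᶠ α) × (M , e ⊨ᶠ β)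
M , e ⊨ᶠ ∃′ α     = ∃[ i ] (M , (i ∷ e) ⊨ᶠ α)

_⊨ᶠ_ : ∀ {p} {P : Set p} → MonadicStructure P I → FO P 0 → Set₁
M ⊨ᶠ α = M , [] ⊨ᶠ α

------------------------------------------------------------------------
-- Type indicators

indicator : ∀ L {k} {Γ : Vec ℕ k} q → (I → Structure τ V) → Assignment V Γ →
            MonadicStructure (Type L τ Γ q) I
indicator L q F a T i = formulas T ≐ type L q (F i) (All.map (_↾ F i) a)

------------------------------------------------------------------------
-- Rooted structures and partitions

-- B selects the distinct monadic symbols B₁,…,B_w of τ.

module _ {τ : Vocabulary} {w : ℕ} (B : Fin w ↣ Symbol τ 1) {V : Set} where

  root : Structure τ V → Fin w → Pred V 0ℓ
  root S ℓ = asSet (rel S (Injection.to B ℓ))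

  Rooted : Structure τ V → Set
  Rooted S = ∀ ℓ → Singleton (root S ℓ)

  bag : Structure τ V → Pred V 0ℓ
  bag S = ⋃ (Fin w) (root S)

  record RootedPartition {I : Set} (S : Structure τ V) (F : I → Structure τ V) : Set where
    field
      covers  : union F ≈ S
      induced : ∀ i → InducedSubstructure (F i) S
      meet    : ∀ {i j} → i ≢ j → universe (F i) ∩ universe (F j) ≐ bag S

-- Forming type(Sᵢ , aᵢ) presupposes that aᵢ is guarded in Sᵢ whenever a is
-- guarded in S.  For GSO a rooted partition need not satisfy this: two bag
-- elements may be adjacent in S only through a ternary tuple of some other
-- Sⱼ.  The two lemmas below show that it is automatic for MSO, and for GSO
-- over vocabularies of arity at most two.

GuardsRestrict : Logic → Structure τ V → (I → Structure τ V) → Set₁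
GuardsRestrict {V = V} L S F =
  ∀ i {r} → VarArity L r → (R : Relation V r) → Guarded S R → Guarded (F i) (R ↾ F i)

guardsRestrict-MSO : (S : Structure τ V) (F : I → Structure τ V) → GuardsRestrict MSO S F
guardsRestrict-MSO S F i refl R _ = proj₂ , λ
  { (x≢y , _ ∷ [] , _ , here x≡ , here y≡) → ⊥-elim (x≢y (trans x≡ (sym y≡))) }

private
  all-of-pair : ∀ {r} {P : Pred V 0ℓ} {x y : V} (v : Vec V r) → r ≤ 2 → x ≢ y →
                x ∈ v → y ∈ v → P x → P y → All P v
  all-of-pair (_ ∷ [])         _ x≢y (here refl) (here refl) _ _ = ⊥-elim (x≢y refl)
  all-of-pair (_ ∷ _ ∷ [])     _ x≢y (here refl) (here refl) _ _ = ⊥-elim (x≢y refl)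
  all-of-pair (_ ∷ _ ∷ [])     _ _   (here refl) (there (here refl)) px py = px ∷ py ∷ []
  all-of-pair (_ ∷ _ ∷ [])     _ _   (there (here refl)) (here refl) px py = py ∷ px ∷ []
  all-of-pair (_ ∷ _ ∷ [])     _ x≢y (there (here refl)) (there (here refl)) _ _ = ⊥-elim (x≢y refl)
  all-of-pair (_ ∷ _ ∷ _ ∷ _) (s≤s (s≤s ())) _ _ _ _ _

guardsRestrict-binary : ∀ L (S : Structure τ V) (F : I → Structure τ V) →
  (∀ {r} → Symbol τ r → r ≤ 2) → (∀ i → InducedSubstructure (F i) S) → GuardsRestrict L S F
guardsRestrict-binary L S F ≤2 ind i _ R (_ , guard) = proj₂ , adj
  where
  adj : gaifmanRel (R ↾ F i) ⇒ gaifman (F i)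
  adj (x≢y , v , (Rv , v⊆) , x∈v , y∈v) with guard (x≢y , v , Rv , x∈v , y∈v)
  ... | r , Z , _ , u , Zu , x∈u , y∈u =
    r , Z , x≢y , u
      , proj₂ (proj₂ (ind i) Z) (Zu , all-of-pair u (≤2 Z) x≢y x∈u y∈u (All.lookup v⊆ x∈v) (All.lookup v⊆ y∈v))
      , x∈u , y∈u

{-# OPTIONS --safe #-}
-- Colour the index i of a part by the rank-q type of (Sᵢ , aᵢ).  The truth of Φ
-- depends only on how often each colour occurs, counted up to a threshold N that
-- is found by induction on Φ.  For an atom N = 2 suffices: one has to detect
-- whether two parts disagree outside the bag.  For ∃X Φ, a relation on S colours
-- the parts once more, by the types of (Sᵢ , Rᵢ aᵢ); a second family with similar
-- counts for the old colours, at a threshold larger by the factor of the number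
-- of new colours, can be recoloured with similar counts, and by the Hintikka
-- property of types the new colours are realised by relations on its parts.
-- These relations fit together, because the type of a part says which tuples of
-- the bag belong to the relation.  Finally, threshold counting is first-order.
module Submission where

open import Defs
open import Axiom.ExcludedMiddle using (ExcludedMiddle)
open import Data.Bool.Base using (Bool; true; false)
open import Data.Empty using (⊥-elim)
open import Data.Fin.Base using (Fin; zero; suc; inject₁; combine; toℕ; fromℕ<)
open import Data.Fin.Properties
  using (combine-injective; inject₁-injective; inject≤-injective; injective⇒≤; suc-injective; toℕ<n; toℕ-fromℕ<)
open import Data.List.Base as List
  using (List; []; _∷_; _++_; length; map; concatMap; cartesianProductWith; allFin; upTo)
open import Data.List.Membership.Propositional using (_∈_; lose)
open import Data.List.Membership.Propositional.Properties
  using (∈-map⁺; ∈-concatMap⁺; ∈-cartesianProductWith⁺; ∈-allFin; ∈-upTo⁺; ∈-++⁺ˡ; ∈-++⁺ʳ)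
open import Data.List.Relation.Unary.Any as Any using (here; there)
open import Data.List.Relation.Unary.Any.Properties using (lookup-index)
open import Data.Nat.Base using (ℕ; zero; suc; _≤_; _⊔_; _*_; z≤n; s≤s)
open import Data.Nat.Properties
  using (≤-refl; ≤-antisym; ≤-irrelevant; n≤1+n; 1+n≰n; m≤n⇒m≤1+n; ⊔-lub; m≤m⊔n; m≤n⊔m; m⊔n≤o⇒m≤o; m⊔n≤o⇒n≤o; _≟_)
open import Data.Product.Base using (Σ-syntax; ∃-syntax; _×_; _,_; proj₁; proj₂; <_,_>; map₂; swap)
open import Data.Product.Function.Dependent.Propositional using (Σ-↔)
open import Data.Sum.Base using (_⊎_; inj₁; inj₂)
open import Data.Unit.Base using (⊤; tt)
open import Data.Vec.Base as Vec using (Vec; []; _∷_)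
import Data.Vec.Membership.Propositional as VecMem
open import Data.Vec.Membership.Propositional.Properties using (∈-lookup)
open import Data.Vec.Relation.Binary.Pointwise.Inductive as Pointwise using (Pointwise; []; _∷_)
open import Data.Vec.Relation.Unary.All as All using (All; []; _∷_)
open import Data.Vec.Relation.Unary.All.Properties using (lookup⁺; lookup⁻)
open import Data.Vec.Relation.Unary.Any using (here; there)
open import Function.Base using (_∘_; case_of_)
open import Function.Bundles using (_↣_; _↔_; _⇔_; Injection; Inverse; Equivalence; mk↣; mk↔ₛ′; mk⇔)
open import Function.Construct.Composition using (_↣-∘_; _↔-∘_)
open import Function.Construct.Identity using (↔-id; ⇔-id)
open import Function.Construct.Symmetry using (↔-sym)
open import Function.Properties.Inverse using (↔⇒↣)
open import Level using (0ℓ; lift; lower) renaming (suc to lsuc; _⊔_ to _⊔ˡ_)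
open import Relation.Binary.PropositionalEquality using (_≡_; _≢_; refl; sym; trans; cong; cong₂; subst)
open import Relation.Nullary.Decidable.Core using (Dec; yes; no)
open import Relation.Nullary.Negation.Core using (¬_)
open import Relation.Unary using (Pred; _⊆_; _≐_; ｛_｝; ⋃)
open import Relation.Unary.Properties using (≐-refl; ≐-sym; ≐-trans)

private
  variable
    A A′ B B′ C K I J V V′ : Set
    k m n q r N : ℕ
    τ : Vocabulary
    Γ : Vec ℕ k

-- Colourings with similar counts

injective∧surjective⇒↔ : (f : A ↣ B) → (∀ b → ∃[ a ] Injection.to f a ≡ b) → A ↔ B
injective∧surjective⇒↔ f surj = mk↔ₛ′ (Injection.to f) (proj₁ ∘ surj) (proj₂ ∘ surj)
  (λ a → Injection.injective f (proj₂ (surj (Injection.to f a))))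

-- Equality of cardinalities truncated at `N`. Index sets may be infinite, so a bijection and a pair
-- of injections take the place of numbers.
Alike : ℕ → Set → Set → Set
Alike N A B = (A ↔ B) ⊎ ((Fin N ↣ A) × (Fin N ↣ B))

Fibre : (I → C) → C → Set
Fibre c k = ∃[ i ] c i ≡ k

-- The colour classes of c and d have the same cardinalities, up to the
-- threshold N.
Similar : ℕ → (I → C) → (J → C) → Set
Similar N c d = ∀ k → Alike N (Fibre c k) (Fibre d k)

alike-sym : Alike N A B → Alike N B A
alike-sym (inj₁ b)       = inj₁ (↔-sym b)
alike-sym (inj₂ (f , g)) = inj₂ (g , f)

alike-mono : m ≤ n → Alike n A B → Alike m A B
alike-mono m≤n (inj₁ b)       = inj₁ b
alike-mono m≤n (inj₂ (f , g)) = inj₂ (f ↣-∘ inj , g ↣-∘ inj)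
  where inj = mk↣ (inject≤-injective m≤n m≤n _ _)

alike-resp-↔ : A ↔ A′ → B ↔ B′ → Alike N A B → Alike N A′ B′
alike-resp-↔ a b (inj₁ e)       = inj₁ (b ↔-∘ (e ↔-∘ ↔-sym a))
alike-resp-↔ a b (inj₂ (f , g)) = inj₂ (↔⇒↣ a ↣-∘ f , ↔⇒↣ b ↣-∘ g)

fibre-≡ : {c : I → C} {k : C} {x y : Fibre c k} → proj₁ x ≡ proj₁ y → x ≡ y
fibre-≡ {x = i , refl} {y = .i , refl} refl = refl

fibre-↔ : {c : A → C} {d : B → C} (b : A ↔ B) → (∀ a → d (Inverse.to b a) ≡ c a) →
          ∀ k → Fibre c k ↔ Fibre d k
fibre-↔ {c = c} {d} b d∘b≗c k = mk↔ₛ′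
  (λ (a , p) → Inverse.to b a , trans (d∘b≗c a) p)
  (λ (y , q) → Inverse.from b y ,
     trans (sym (d∘b≗c (Inverse.from b y))) (trans (cong d (Inverse.strictlyInverseˡ b y)) q))
  (λ (y , _) → fibre-≡ (Inverse.strictlyInverseˡ b y))
  (λ (a , _) → fibre-≡ (Inverse.strictlyInverseʳ b a))

fibre-pair-↔ : (t : I → K) (c : I → C) {k : K} (d : Fibre t k → C) → (∀ x → d x ≡ c (proj₁ x)) →
               ∀ l → Fibre d l ↔ Fibre < t , c > (k , l)
fibre-pair-↔ t c d d≗c l = mk↔ₛ′
  (λ ((i , p) , q) → i , cong₂ _,_ p (trans (sym (d≗c (i , p))) q))
  (λ (i , r) → (i , cong proj₁ r) , trans (d≗c _) (cong proj₂ r))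
  (λ _ → fibre-≡ refl)
  (λ _ → fibre-≡ (fibre-≡ refl))

fibre-∘-↔ : (f : K → C) (c : I → K) → ∀ l → (Σ[ x ∈ Fibre f l ] Fibre c (proj₁ x)) ↔ Fibre (f ∘ c) l
fibre-∘-↔ f c l = mk↔ₛ′
  (λ ((k , p) , (i , q)) → i , trans (cong f q) p)
  (λ (i , p) → (c i , p) , (i , refl))
  (λ _ → fibre-≡ refl)
  (λ { ((_ , p) , (i , refl)) → refl })

similar-sym : {c : I → C} {d : J → C} → Similar N c d → Similar N d c
similar-sym s k = alike-sym (s k)

similar-mono : {c : I → C} {d : J → C} → m ≤ n → Similar n c d → Similar m c d
similar-mono m≤n s k = alike-mono m≤n (s k)

similar-resp-≗ : {C : Set} {N : ℕ} {c : I → C} {d e : J → C} → (∀ j → e j ≡ d j) → Similar N c d → Similar N c e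
similar-resp-≗ e≗d s k = alike-resp-↔ (↔-id _) (fibre-↔ (↔-id _) e≗d k) (s k)

-- A positive threshold excludes that a colour occurs on one side only: either alternative yields an
-- element of the class of `c`.
similar⇒match : {c : I → C} {d : J → C} → Similar (suc N) c d → ∀ j → ∃[ i ] c i ≡ d j
similar⇒match {d = d} s j with s (d j)
... | inj₁ b       = Inverse.from b (j , refl)
... | inj₂ (f , _) = Injection.to f zero

-- Threshold cardinalities and recolouring

module _ (em : ∀ ℓ → ExcludedMiddle ℓ) where

  decide : ∀ {ℓ} (P : Set ℓ) → Dec P
  decide P = em _

  -- By induction on `N`: an injection of `Fin N` either misses an element, which extends it by one,
  -- or is onto and hence a bijection.
  atLeast⊎finite : ∀ N (A : Set) → (Fin N ↣ A) ⊎ (∃[ m ] (m ≤ N × (A ↔ Fin m)))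
  atLeast⊎finite zero A = inj₁ (mk↣ {to = λ ()} λ { {()} })
  atLeast⊎finite (suc N) A with atLeast⊎finite N A
  ... | inj₂ (m , m≤N , b) = inj₂ (m , m≤n⇒m≤1+n m≤N , b)
  ... | inj₁ f with decide (∃[ a ] ∀ i → Injection.to f i ≢ a)
  ...   | yes (a , a∉f) = inj₁ (mk↣ {to = g} g-injective)
    where
    g : Fin (suc N) → A
    g zero    = a
    g (suc i) = Injection.to f i
    g-injective : ∀ {i j} → g i ≡ g j → i ≡ j
    g-injective {zero}  {zero}  _ = refl
    g-injective {zero}  {suc j} e = ⊥-elim (a∉f j (sym e))
    g-injective {suc i} {zero}  e = ⊥-elim (a∉f i e)
    g-injective {suc i} {suc j} e = cong suc (Injection.injective f e)
  ...   | no f-covers = inj₂ (N , n≤1+n N , ↔-sym (injective∧surjective⇒↔ f surj))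
    where
    surj : ∀ a → ∃[ i ] Injection.to f i ≡ a
    surj a with decide (∃[ i ] Injection.to f i ≡ a)
    ... | yes x = x
    ... | no ∄i = ⊥-elim (f-covers (a , λ i e → ∄i (i , e)))

  atLeast⊎atMost : ∀ N (A : Set) → (Fin N ↣ A) ⊎ (A ↣ Fin N)
  atLeast⊎atMost N A with atLeast⊎finite N A
  ... | inj₁ f             = inj₁ f
  ... | inj₂ (m , m≤N , b) = inj₂ (mk↣ (inject≤-injective m≤N m≤N _ _) ↣-∘ ↔⇒↣ b)

  -- One summand that is large on both sides makes both sums large. If there is none, every summand
  -- comes with a bijection, and these combine.
  alike-Σ : {X : Set} {P Q : X → Set} → (∀ x → Alike N (P x) (Q x)) → Alike N (Σ[ x ∈ X ] P x) (Σ[ x ∈ X ] Q x)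
  alike-Σ {N = N} {X} {P} {Q} alike with decide (∃[ x ] ((Fin N ↣ P x) × (Fin N ↣ Q x)))
  ... | yes (x , f , g) = inj₂ (inside ↣-∘ f , inside ↣-∘ g)
    where
    inside : {R : X → Set} → R x ↣ (Σ[ x ∈ X ] R x)
    inside = mk↣ {to = x ,_} λ { refl → refl }
  ... | no small = inj₁ (Σ-↔ (↔-id X) (λ {x} → bijection x))
    where
    bijection : ∀ x → P x ↔ Q x
    bijection x with alike x
    ... | inj₁ b  = b
    ... | inj₂ fg = ⊥-elim (small (x , fg))

  -- Merging colours along `f` makes each new class a disjoint union of old ones.
  similar-∘ : (f : K → C) {c : I → K} {d : J → K} → Similar N c d → Similar N (f ∘ c) (f ∘ d)
  similar-∘ f {c} {d} s l = alike-resp-↔ (fibre-∘-↔ f c l) (fibre-∘-↔ f d l) (alike-Σ λ x → s (proj₁ x))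

  -- Differently coloured indices are matched separately, and their matches differ by colour. For
  -- equal colours the class has two elements, which threshold 2 carries over.
  similar⇒match₂ : {c : I → C} {d : J → C} → Similar 2 c d → ∀ {i j} → i ≢ j →
                   ∃[ i′ ] ∃[ j′ ] (i′ ≢ j′ × c i′ ≡ d i × c j′ ≡ d j)
  similar⇒match₂ {c = c} {d} s {i} {j} i≢j with decide (d i ≡ d j)
  ... | no di≢dj with similar⇒match s i | similar⇒match s j
  ...   | i′ , p | j′ , q = i′ , j′ , (λ { refl → di≢dj (trans (sym p) q) }) , p , q
  similar⇒match₂ {c = c} {d} s {i} {j} i≢j | yes di≡dj with s (d j)
  ... | inj₂ (f , _) = proj₁ (Injection.to f zero) , proj₁ (Injection.to f (suc zero)) ,
        (λ e → 0≢1 (Injection.injective f (fibre-≡ e))) ,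
        trans (proj₂ (Injection.to f zero)) (sym di≡dj) , proj₂ (Injection.to f (suc zero))
    where
    0≢1 : zero {n = 1} ≢ suc zero
    0≢1 ()
  ... | inj₁ b = proj₁ i′ , proj₁ j′ , (λ e → i≢j (cong proj₁ (from-injective (fibre-≡ e)))) ,
        trans (proj₂ i′) (sym di≡dj) , proj₂ j′
    where
    i′ = Inverse.from b (i , di≡dj)
    j′ = Inverse.from b (j , refl)
    from-injective : ∀ {x y} → Inverse.from b x ≡ Inverse.from b y → x ≡ y
    from-injective {x} {y} e = trans (sym (Inverse.strictlyInverseˡ b x))
      (trans (cong (Inverse.to b) e) (Inverse.strictlyInverseˡ b y))

  module _ (fin : C ↣ Fin n) where

    -- Pigeonhole principle: if no class had `N` elements, colour and position within the class
    -- would inject `n * N + 1` elements into `n * N` places.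
    popular : ∀ N → (Fin (suc (n * N)) ↣ A) → (c : A → C) → ∃[ k ] (Fin N ↣ Fibre c k)
    popular N g c with decide (∃[ k ] (Fin N ↣ Fibre c k))
    ... | yes p = p
    ... | no unpopular = ⊥-elim (1+n≰n (injective⇒≤ (Injection.injective (mk↣ place-injective ↣-∘ g))))
      where
      small : ∀ k → Fibre c k ↣ Fin N
      small k with atLeast⊎atMost N (Fibre c k)
      ... | inj₁ f = ⊥-elim (unpopular (k , f))
      ... | inj₂ h = h
      place : _ → Fin (n * N)
      place a = combine (Injection.to fin (c a)) (Injection.to (small (c a)) (a , refl))
      same : ∀ {a b k l} (p : c a ≡ k) (q : c b ≡ l) → k ≡ l →
             Injection.to (small k) (a , p) ≡ Injection.to (small l) (b , q) → a ≡ b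
      same p q refl e = cong proj₁ (Injection.injective (small _) e)
      place-injective : ∀ {a b} → place a ≡ place b → a ≡ b
      place-injective e with combine-injective _ _ _ _ e
      ... | e₁ , e₂ = same refl refl (Injection.injective fin e₁) e₂

    -- Colour classes with fewer than N elements are copied into N reserved
    -- places each, the others get all N of theirs, and one large class
    -- absorbs everything left over.
    recolour : ∀ N → Alike (suc (n * N)) A B → (c : A → C) → Σ[ d ∈ (B → C) ] Similar N c d
    recolour N (inj₁ b) c = c ∘ Inverse.from b ,
      λ k → inj₁ (fibre-↔ b (λ a → cong c (Inverse.strictlyInverseʳ b a)) k)
    recolour {A = A} {B} N (inj₂ (f , g)) c = d , similar
      where
      rest = proj₁ (popular N f c)

      -- The place numbered `s` of colour `l`. Only `n * N` of the given points are reserved, so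
      -- `inject₁` skips the last one.
      slot : C → Fin N → B
      slot l s = Injection.to g (inject₁ (combine (Injection.to fin l) s))

      slot-injective : ∀ {l l′ s s′} → slot l s ≡ slot l′ s′ → l ≡ l′ × s ≡ s′
      slot-injective e with combine-injective _ _ _ _ (inject₁-injective (Injection.injective g e))
      ... | e₁ , e₂ = Injection.injective fin e₁ , e₂

      Taken : ∀ {l} → (Fin N ↣ Fibre c l) ⊎ (Fibre c l ↣ Fin N) → Fin N → Set
      Taken (inj₁ _) s = ⊤
      Taken (inj₂ h) s = ∃[ x ] Injection.to h x ≡ s

      size : ∀ l → (Fin N ↣ Fibre c l) ⊎ (Fibre c l ↣ Fin N)
      size l = atLeast⊎atMost N (Fibre c l)

      Owner : B → C → Set
      Owner b l = ∃[ s ] (slot l s ≡ b × Taken (size l) s)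

      d : B → C
      d b with decide (∃[ l ] Owner b l)
      ... | yes (l , _) = l
      -- Everything not taken gets the popular colour, whose class is large anyway and so tolerates
      -- any surplus.
      ... | no _        = rest

      d-slot : ∀ l s → Taken (size l) s → d (slot l s) ≡ l
      d-slot l s t with decide (∃[ l′ ] Owner (slot l s) l′)
      ... | yes (_ , _ , e , _) = proj₁ (slot-injective e)
      ... | no free             = ⊥-elim (free (l , s , refl , t))

      -- The places of `rest` keep this colour even when free, because it is also the default.
      d-rest : ∀ s → d (slot rest s) ≡ rest
      d-rest s with decide (∃[ l′ ] Owner (slot rest s) l′)
      ... | yes (_ , _ , e , _) = proj₁ (slot-injective e)
      ... | no _                = refl

      d⇒owner : ∀ b → d b ≢ rest → Owner b (d b)
      d⇒owner b ≢rest with decide (∃[ l ] Owner b l)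
      ... | yes (_ , o) = o
      ... | no _        = ⊥-elim (≢rest refl)

      large : ∀ l → (∀ s → d (slot l s) ≡ l) → Fin N ↣ Fibre d l
      large l all = mk↣ {to = λ s → slot l s , all s} (proj₂ ∘ slot-injective ∘ cong proj₁)

      similar : Similar N c d
      similar l with decide (l ≡ rest)
      ... | yes refl = inj₂ (proj₂ (popular N f c) , large rest d-rest)
      ... | no l≢rest with size l in eq
      ...   | inj₁ h = inj₂ (h , large l (λ s → d-slot l s (subst (λ z → Taken z s) (sym eq) tt)))
      ...   | inj₂ h = inj₁ (injective∧surjective⇒↔ (mk↣ {to = copy} copy-injective) copy-surjective)
        where
        copy : Fibre c l → Fibre d l
        copy x = slot l (Injection.to h x) , d-slot l _ (subst (λ z → Taken z _) (sym eq) (x , refl))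
        copy-injective : ∀ {x y} → copy x ≡ copy y → x ≡ y
        copy-injective e = Injection.injective h (proj₂ (slot-injective (cong proj₁ e)))
        copy-surjective : ∀ y → ∃[ x ] copy x ≡ y
        copy-surjective (b , p) with subst (Owner b) p (d⇒owner b (λ e → l≢rest (trans (sym p) e)))
        ... | s , e , t with subst (λ z → Taken z s) eq t
        ...   | x , e′ = x , fibre-≡ (trans (cong (slot l) e′) e)

    -- Each class of the old colouring is recoloured on its own, and the results are glued to one
    -- colouring of `J`.
    refine : ∀ N {t : I → K} {t′ : J → K} → Similar (suc (n * N)) t t′ → (c : I → C) →
             Σ[ c′ ∈ (J → C) ] Similar N < t , c > < t′ , c′ >
    refine {K = K} {J = J} N {t} {t′} s c = c′ , λ (k , l) →
      alike-resp-↔ (fibre-pair-↔ t c (c ∘ proj₁) (λ _ → refl) l)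
                   (fibre-pair-↔ t′ c′ (proj₁ (new k)) (λ { (_ , refl) → refl }) l)
                   (proj₂ (new k) l)
      where
      new : ∀ k → Σ[ d ∈ (Fibre t′ k → C) ] Similar N (c ∘ proj₁) d
      new k = recolour N (s k) (c ∘ proj₁)
      c′ : J → C
      c′ j = proj₁ (new (t′ j)) (j , refl)

-- Finite enumerations

Listable : ∀ {ℓ} → Set ℓ → Set ℓ
Listable A = Σ[ xs ∈ List A ] (∀ x → x ∈ xs)

listable⇒↣ : ∀ {A : Set} ((xs , _) : Listable A) → A ↣ Fin (length xs)
listable⇒↣ (xs , all) = mk↣ {to = λ x → Any.index (all x)}
  λ {x} {y} e → trans (lookup-index (all x)) (trans (cong (List.lookup xs) e) (sym (lookup-index (all y))))

module _ {A : Set} where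

  listable-Σ : {B : A → Set} → Listable A → (∀ x → Listable (B x)) → Listable (Σ[ x ∈ A ] B x)
  listable-Σ (xs , all) ls = concatMap (λ x → map (x ,_) (proj₁ (ls x))) xs ,
    λ (x , y) → ∈-concatMap⁺ (λ z → map (z ,_) (proj₁ (ls z)))
      (lose {P = λ z → (x , y) ∈ map (z ,_) (proj₁ (ls z))} (all x) (∈-map⁺ (x ,_) (proj₂ (ls x) y)))

  listable-⊎ : {B C : Set} → (f : A → C) (g : B → C) → (∀ c → (∃[ x ] f x ≡ c) ⊎ (∃[ y ] g y ≡ c)) →
               Listable A → Listable B → Listable C
  listable-⊎ f g cover (xs , allˣ) (ys , allʸ) = map f xs ++ map g ys , all
    where
    all : ∀ c → c ∈ map f xs ++ map g ys
    all c with cover c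
    ... | inj₁ (x , refl) = ∈-++⁺ˡ (∈-map⁺ f (allˣ x))
    ... | inj₂ (y , refl) = ∈-++⁺ʳ (map f xs) (∈-map⁺ g (allʸ y))

  listable-Vec : Listable A → ∀ n → Listable (Vec A n)
  listable-Vec l zero = [] ∷ [] , λ { [] → here refl }
  listable-Vec l@(xs , all) (suc n) = cartesianProductWith _∷_ xs (proj₁ (listable-Vec l n)) ,
    λ { (x ∷ v) → ∈-cartesianProductWith⁺ _∷_ (all x) (proj₂ (listable-Vec l n) v) }

listable-Bool : Listable Bool
listable-Bool = true ∷ false ∷ [] , λ { true → here refl ; false → there (here refl) }

listable-at : {P : ℕ → Set} → Listable (Σ[ r ∈ ℕ ] P r) → ∀ r → Listable (P r)
listable-at {P} (xs , all) r = concatMap pick xs , λ p →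
    ∈-concatMap⁺ pick (lose {P = λ y → p ∈ pick y} (all (r , p)) (picked p))
  where
  pick : Σ[ r ∈ ℕ ] P r → List (P r)
  pick (s , p) with s ≟ r
  ... | yes refl = p ∷ []
  ... | no _     = []
  picked : ∀ p → p ∈ pick (r , p)
  picked p with r ≟ r
  ... | yes refl = here refl
  ... | no r≢r   = ⊥-elim (r≢r refl)

listable-Symbol : ∀ τ → Listable (Σ[ r ∈ ℕ ] Symbol τ r)
listable-Symbol []      = [] , λ ()
listable-Symbol (r ∷ τ) = (r , here refl) ∷ map (map₂ there) (proj₁ (listable-Symbol τ)) , λ
  { (_ , here refl) → here refl
  ; (s , there Z)   → there (∈-map⁺ (map₂ there) (proj₂ (listable-Symbol τ) (s , Z))) }

listable-Var : (Γ : Vec ℕ k) → Listable (Σ[ r ∈ ℕ ] r VecMem.∈ Γ)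
listable-Var []      = [] , λ ()
listable-Var (r ∷ Γ) = (r , here refl) ∷ map (map₂ there) (proj₁ (listable-Var Γ)) , λ
  { (_ , here refl) → here refl
  ; (s , there X)   → there (∈-map⁺ (map₂ there) (proj₂ (listable-Var Γ) (s , X))) }

listable-RelTerm : ∀ τ (Γ : Vec ℕ k) → Listable (Σ[ r ∈ ℕ ] RelTerm τ Γ r)
listable-RelTerm τ Γ = listable-⊎ (map₂ con) (map₂ var)
  (λ { (r , con Z) → inj₁ ((r , Z) , refl) ; (r , var X) → inj₂ ((r , X) , refl) })
  (listable-Symbol τ) (listable-Var Γ)

-- Here the arity bound of GSO matters: it leaves finitely many kinds of quantifier.
listable-VarArity : ∀ L → Listable (Σ[ r ∈ ℕ ] VarArity L r)
listable-VarArity MSO     = (1 , refl) ∷ [] , λ { (_ , refl) → here refl }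
listable-VarArity (GSO m) = map arity (allFin m) , λ { (suc r , s≤s z≤n , r<m) →
    subst (_∈ map arity (allFin m)) (unique (cong suc (toℕ-fromℕ< r<m))) (∈-map⁺ arity (∈-allFin (fromℕ< r<m))) }
  where
  arity : Fin m → Σ[ r ∈ ℕ ] VarArity (GSO m) r
  arity i = suc (toℕ i) , s≤s z≤n , toℕ<n i
  unique : {x y : Σ[ r ∈ ℕ ] VarArity (GSO m) r} → proj₁ x ≡ proj₁ y → x ≡ y
  unique {r , p , p′} {.r , q , q′} refl = cong (r ,_) (cong₂ _,_ (≤-irrelevant p q) (≤-irrelevant p′ q′))

-- Types as finitely many colours

module _ (em : ∀ ℓ → ExcludedMiddle ℓ) where

  truthValue : Set₁ → Bool
  truthValue P with decide em P
  ... | yes _ = true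
  ... | no _  = false

  truthValue-≡ : {P Q : Set₁} → truthValue P ≡ truthValue Q → P → Q
  truthValue-≡ {P} {Q} e p with decide em P | decide em Q
  ... | yes _ | yes y = y
  ... | no ¬p | _     = ⊥-elim (¬p p)

  truthValue-cong : {P Q : Set₁} → (P → Q) → (Q → P) → truthValue P ≡ truthValue Q
  truthValue-cong {P} {Q} f g with decide em P | decide em Q
  ... | yes _ | yes _ = refl
  ... | no _  | no _  = refl
  ... | yes p | no ¬q = ⊥-elim (¬q (f p))
  ... | no ¬p | yes q = ⊥-elim (¬p (g q))

  module _ {f} {F : Set f} where

    truth : (F → Set₁) → (φs : List F) → Vec Bool (length φs)
    truth T []       = []
    truth T (φ ∷ φs) = truthValue (T φ) ∷ truth T φs

    truth-≡ : {T U : F → Set₁} {φs : List F} → truth T φs ≡ truth U φs → ∀ {φ} → φ ∈ φs → T φ → U φ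
    truth-≡ e (here refl) = truthValue-≡ (cong Vec.head e)
    truth-≡ e (there φ∈)  = truth-≡ (cong Vec.tail e) φ∈

    truth-cong : {T U : F → Set₁} → (∀ φ → T φ → U φ) → (∀ φ → U φ → T φ) → ∀ φs → truth T φs ≡ truth U φs
    truth-cong f g []       = refl
    truth-cong f g (φ ∷ φs) = cong₂ _∷_ (truthValue-cong (f φ) (g φ)) (truth-cong f g φs)

  -- Boolean combinations of finitely many formulas

  module BooleanCombination {f} {F : Set f} (not : F → F) (and : F → F → F) (φ₀ : F) where

    -- Semantics enters only through these two clauses, so the construction serves both the
    -- second-order formulas and the first-order sentences about type indicators.
    record Valuation (T : F → Set₁) : Set (f ⊔ˡ lsuc 0ℓ) where
      field
        not⇔ : ∀ {φ} → T (not φ) ⇔ (¬ T φ)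
        and⇔ : ∀ {φ ψ} → T (and φ ψ) ⇔ (T φ × T ψ)

    false′ : F
    false′ = and φ₀ (not φ₀)

    literal : Bool → F → F
    literal true  φ = φ
    literal false φ = not φ

    -- The state description: a conjunction that fixes the truth value of every listed formula.
    hintikka : (φs : List F) → Vec Bool (length φs) → F
    hintikka []       []      = not false′
    hintikka (φ ∷ φs) (b ∷ v) = and (literal b φ) (hintikka φs v)

    disjunction : (φs : List F) → (Vec Bool (length φs) → Set₁) → List (Vec Bool (length φs)) → F
    disjunction φs Good []       = false′
    disjunction φs Good (v ∷ vs) with decide em (Good v)
    ... | yes _ = not (and (not (hintikka φs v)) (not (disjunction φs Good vs)))
    ... | no _  = disjunction φs Good vs

    combination : (φs : List F) → (Vec Bool (length φs) → Set₁) → F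
    combination φs Good = disjunction φs Good (proj₁ (listable-Vec listable-Bool (length φs)))

    module _ {T : F → Set₁} (val : Valuation T) where
      open Valuation val

      T-not⁺ : ∀ {φ} → ¬ T φ → T (not φ)
      T-not⁺ = Equivalence.from not⇔

      T-not⁻ : ∀ {φ} → T (not φ) → ¬ T φ
      T-not⁻ = Equivalence.to not⇔

      ¬T-false′ : ¬ T false′
      ¬T-false′ t with Equivalence.to and⇔ t
      ... | p , ¬p = T-not⁻ ¬p p

      T-literal⁺ : ∀ φ → T (literal (truthValue (T φ)) φ)
      T-literal⁺ φ with decide em (T φ)
      ... | yes p = p
      ... | no ¬p = T-not⁺ ¬p

      T-literal⁻ : ∀ b φ → T (literal b φ) → truthValue (T φ) ≡ b
      T-literal⁻ b φ p with decide em (T φ)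
      T-literal⁻ true  φ p  | yes _ = refl
      T-literal⁻ false φ p  | no _  = refl
      T-literal⁻ true  φ p  | no ¬p = ⊥-elim (¬p p)
      T-literal⁻ false φ ¬p | yes p = ⊥-elim (T-not⁻ ¬p p)

      T-hintikka⁺ : ∀ φs → T (hintikka φs (truth T φs))
      T-hintikka⁺ []       = T-not⁺ ¬T-false′
      T-hintikka⁺ (φ ∷ φs) = Equivalence.from and⇔ (T-literal⁺ φ , T-hintikka⁺ φs)

      T-hintikka⁻ : ∀ φs v → T (hintikka φs v) → truth T φs ≡ v
      T-hintikka⁻ []       []      _ = refl
      T-hintikka⁻ (φ ∷ φs) (b ∷ v) t with Equivalence.to and⇔ t
      ... | p , ps = cong₂ _∷_ (T-literal⁻ b φ p) (T-hintikka⁻ φs v ps)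

      -- A state description is true only for the actual vector of truth values, so the disjunction
      -- over all good vectors holds exactly if that vector is good.
      T-combination : ∀ φs Good → T (combination φs Good) ⇔ Good (truth T φs)
      T-combination φs Good = mk⇔ (sound (proj₁ l)) (complete (proj₁ l) (proj₂ l _))
        where
        l = listable-Vec listable-Bool (length φs)
        sound : ∀ vs → T (disjunction φs Good vs) → Good (truth T φs)
        sound []       t = ⊥-elim (¬T-false′ t)
        sound (v ∷ vs) t with decide em (Good v)
        ... | no _  = sound vs t
        ... | yes g with decide em (T (hintikka φs v))
        ...   | yes h = subst Good (sym (T-hintikka⁻ φs v h)) g
        ...   | no ¬h = sound vs (case decide em (T (disjunction φs Good vs)) of λ
                { (yes d) → d
                ; (no ¬d) → ⊥-elim (T-not⁻ t (Equivalence.from and⇔ (T-not⁺ ¬h , T-not⁺ ¬d))) })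
        complete : ∀ vs → truth T φs ∈ vs → Good (truth T φs) → T (disjunction φs Good vs)
        complete (v ∷ vs) v∈ g with decide em (Good v)
        complete (_ ∷ vs) (here refl) g | no ¬g = ⊥-elim (¬g g)
        complete (_ ∷ vs) (there v∈)  g | no _  = complete vs v∈ g
        complete (_ ∷ vs) v∈          g | yes _ = T-not⁺ λ t → case v∈ of λ
          { (here refl) → T-not⁻ (proj₁ (Equivalence.to and⇔ t)) (T-hintikka⁺ φs)
          ; (there v∈)  → T-not⁻ (proj₂ (Equivalence.to and⇔ t)) (complete vs v∈ g) }

  -- Hintikka formulas and the colour of a type

  module Types (L : Logic) (τ : Vocabulary) where

    Sentence : ∀ {k} → Vec ℕ k → ℕ → Set
    Sentence Γ q = Σ[ Φ ∈ Formula L τ Γ ] rank Φ ≤ q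

    Holds : Structure τ V → Assignment V Γ → Sentence Γ q → Set₁
    Holds S a (Φ , _) = S , a ⊨ Φ

    negation : Sentence Γ q → Sentence Γ q
    negation (Φ , Φ≤q) = ¬′ Φ , Φ≤q

    conjunction : Sentence Γ q → Sentence Γ q → Sentence Γ q
    conjunction (Φ , Φ≤q) (Ψ , Ψ≤q) = Φ ∧′ Ψ , ⊔-lub Φ≤q Ψ≤q

    open module Combination {k} {Γ : Vec ℕ k} {q} = BooleanCombination {F = Sentence Γ q} negation conjunction

    holds : (φ₀ : Sentence Γ q) (S : Structure τ V) (a : Assignment V Γ) → Valuation φ₀ (Holds S a)
    holds φ₀ S a = record { not⇔ = ⇔-id _ ; and⇔ = ⇔-id _ }

    atoms : ∀ {q} → List (Sentence Γ q)
    atoms {Γ = Γ} = map emptyAtom (proj₁ terms₁) ++ map elemAtom (proj₁ elems)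
      where
      terms  = listable-RelTerm τ Γ
      terms₁ = listable-at terms 1
      elems  = listable-Σ terms (λ (r , _) → listable-Vec terms₁ r)
      emptyAtom : RelTerm τ Γ 1 → Sentence Γ _
      emptyAtom X = empty X , z≤n
      elemAtom : Σ[ (r , _) ∈ Σ[ r ∈ ℕ ] RelTerm τ Γ r ] Vec (RelTerm τ Γ 1) r → Sentence Γ _
      elemAtom ((r , Z) , Ys) = elem Ys Z , z≤n

    private
      variable
        S : Structure τ V
        S′ : Structure τ V′

    opaque

      -- The Hintikka formula below an existential quantifier needs some formula
      -- to build a tautology from, and without atoms there may be none of the
      -- given rank.
      basis : ∀ {k} (Γ : Vec ℕ k) q → List (Sentence Γ q)
      existentials : ∀ {k} (Γ : Vec ℕ k) q → Σ[ r ∈ ℕ ] VarArity L r → List (Sentence Γ (suc q))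

      basis Γ zero    = atoms
      -- One existential formula for each arity and each colour of rank `q` is enough; the truth of
      -- all other formulas of this rank is determined by these and the atoms.
      basis Γ (suc q) = atoms ++ concatMap (existentials Γ q) (proj₁ (listable-VarArity L))

      existentials Γ q (r , va) with decide em (Sentence (r ∷ Γ) q)
      ... | no _   = []
      ... | yes φ₀ = map quantify (proj₁ (listable-Vec listable-Bool (length (basis (r ∷ Γ) q))))
        where
        quantify : Vec Bool (length (basis (r ∷ Γ) q)) → Sentence Γ (suc q)
        quantify v with hintikka φ₀ (basis (r ∷ Γ) q) v
        ... | Φ , Φ≤q = ∃′ r va Φ , s≤s Φ≤q

      Colour : ∀ {k} → Vec ℕ k → ℕ → Set
      Colour Γ q = Vec Bool (length (basis Γ q))

      listable-Colour : ∀ {k} (Γ : Vec ℕ k) q → Listable (Colour Γ q)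
      listable-Colour Γ q = listable-Vec listable-Bool (length (basis Γ q))

      colour : ∀ {k} {Γ : Vec ℕ k} q → Structure τ V → Assignment V Γ → Colour Γ q
      colour {Γ = Γ} q S a = truth (Holds S a) (basis Γ q)

      empty∈atoms : (X : RelTerm τ Γ 1) → (empty X , z≤n) ∈ atoms {Γ = Γ} {q = q}
      empty∈atoms {Γ = Γ} X = ∈-++⁺ˡ (∈-map⁺ _ (proj₂ (listable-at (listable-RelTerm τ Γ) 1) X))

      elem∈atoms : (Ys : Vec (RelTerm τ Γ 1) r) (Z : RelTerm τ Γ r) → (elem Ys Z , z≤n) ∈ atoms {Γ = Γ} {q = q}
      elem∈atoms {Γ = Γ} Ys Z = ∈-++⁺ʳ _ (∈-map⁺ _
        (proj₂ (listable-Σ terms (λ (r , _) → listable-Vec (listable-at terms 1) r)) ((_ , Z) , Ys)))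
        where
        terms : Listable (Σ[ r ∈ ℕ ] RelTerm τ Γ r)
        terms = listable-RelTerm τ Γ

      atoms⊆basis : ∀ q {φ : Sentence Γ q} → φ ∈ atoms → φ ∈ basis Γ q
      atoms⊆basis zero    φ∈ = φ∈
      atoms⊆basis (suc q) φ∈ = ∈-++⁺ˡ φ∈

      -- The back-and-forth property. The colour of `R ∷ a` is described by a Hintikka formula whose
      -- existential closure is in the basis, so it holds in `S′` too, and any witness there has the
      -- same colour.
      extend : {a : Assignment V Γ} {a′ : Assignment V′ Γ} →
               colour (suc q) S a ≡ colour (suc q) S′ a′ →
               VarArity L r → Sentence (r ∷ Γ) q → (R : Relation V r) → Guarded S R →
               Σ[ R′ ∈ Relation V′ r ] (Guarded S′ R′ × colour q S (R ∷ a) ≡ colour q S′ (R′ ∷ a′))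
      extend {Γ = Γ} {q = q} {S = S} {S′ = S′} {r = r} {a} {a′} same va φ R guarded =
        map₂ (map₂ λ h → sym (T-hintikka⁻ top (holds top S′ _) (basis (r ∷ Γ) q) v h)) extension
        where
        v : Colour (r ∷ Γ) q
        v = colour q S (R ∷ a)
        any-formula : Dec (Sentence (r ∷ Γ) q) → Sentence (r ∷ Γ) q
        any-formula (yes φ₀) = φ₀
        any-formula (no _)   = φ
        -- The decision is the one made in `existentials`, so that both build the same Hintikka
        -- formula; `φ` refutes its negative outcome.
        top : Sentence (r ∷ Γ) q
        top = any-formula (decide em (Sentence (r ∷ Γ) q))
        χ : Sentence (r ∷ Γ) q
        χ = hintikka top (basis (r ∷ Γ) q) v
        ∃χ : Sentence Γ (suc q)
        ∃χ = (∃′ r va (proj₁ χ) , s≤s (proj₂ χ))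
        ∃χ∈existentials : ∃χ ∈ existentials Γ q (r , va)
        ∃χ∈existentials with decide em (Sentence (r ∷ Γ) q)
        ... | no ∄φ  = ⊥-elim (∄φ φ)
        ... | yes φ₀ = ∈-map⁺ _ (proj₂ (listable-Vec listable-Bool _) v)
        extension : S′ , a′ ⊨ proj₁ ∃χ
        extension = truth-≡ {T = Holds S a} {U = Holds S′ a′} {φs = basis Γ (suc q)} same
          (∈-++⁺ʳ (atoms {Γ = Γ}) (∈-concatMap⁺ (existentials Γ q)
            (lose {P = λ x → ∃χ ∈ existentials Γ q x} (proj₂ (listable-VarArity L) (r , va)) ∃χ∈existentials)))
          (R , guarded , T-hintikka⁺ top (holds top S (R ∷ a)) (basis (r ∷ Γ) q))

      -- Induction on the formula. One direction suffices, since negation reverses the equality of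
      -- colours; quantifiers are handled by `extend`.
      colour⇒⊨ : {a : Assignment V Γ} {a′ : Assignment V′ Γ} → colour q S a ≡ colour q S′ a′ →
                 (Φ : Formula L τ Γ) → rank Φ ≤ q → S , a ⊨ Φ → S′ , a′ ⊨ Φ
      colour⇒⊨ {q = q} same (empty X) _ = truth-≡ same (atoms⊆basis q (empty∈atoms X))
      colour⇒⊨ {q = q} same (elem Ys Z) _ = truth-≡ same (atoms⊆basis q (elem∈atoms Ys Z))
      colour⇒⊨ same (¬′ Φ) Φ≤q ¬h h = ¬h (colour⇒⊨ (sym same) Φ Φ≤q h)
      colour⇒⊨ same (Φ ∧′ Ψ) ≤q (h , h′) =
        colour⇒⊨ same Φ (m⊔n≤o⇒m≤o _ _ ≤q) h , colour⇒⊨ same Ψ (m⊔n≤o⇒n≤o _ _ ≤q) h′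
      colour⇒⊨ same (∃′ r va Φ) (s≤s Φ≤q) (R , guarded , h) with extend same va (Φ , Φ≤q) R guarded
      ... | R′ , guarded′ , same′ = R′ , guarded′ , colour⇒⊨ same′ Φ Φ≤q h

      colour⇒type : {a : Assignment V Γ} {a′ : Assignment V′ Γ} → colour q S a ≡ colour q S′ a′ →
                    type L q S a ≐ type L q S′ a′
      colour⇒type same = (λ {Φ} (Φ≤q , h) → Φ≤q , colour⇒⊨ same Φ Φ≤q h) ,
                         (λ {Φ} (Φ≤q , h) → Φ≤q , colour⇒⊨ (sym same) Φ Φ≤q h)

      type⇒colour : {a : Assignment V Γ} {a′ : Assignment V′ Γ} → type L q S a ≐ type L q S′ a′ →
                    colour q S a ≡ colour q S′ a′
      type⇒colour (⊆ , ⊇) = truth-cong (λ (Φ , Φ≤q) h → proj₂ (⊆ (Φ≤q , h))) (λ (Φ , Φ≤q) h → proj₂ (⊇ (Φ≤q , h))) _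

-- Rooted partitions

lookup-map : {P Q : ℕ → Set₁} (f : ∀ {x} → P x → Q x) (ps : All P Γ) (X : r VecMem.∈ Γ) →
             All.lookup (All.map f ps) X ≡ f (All.lookup ps X)
lookup-map f (p ∷ ps) (here refl) = refl
lookup-map f (p ∷ ps) (there X)   = lookup-map f ps X

Members : Structure τ V → Assignment V Γ → Vec (RelTerm τ Γ 1) m → Vec V r → Set
Members S a = Pointwise (λ Y x → asSet (⟦ Y ⟧ S a) x)

Singletons : Structure τ V → Assignment V Γ → Vec (RelTerm τ Γ 1) r → Set
Singletons S a Ys = ∀ j → Singleton (asSet (⟦ Vec.lookup Ys j ⟧ S a))

singleton-unique : {P : Pred V 0ℓ} → Singleton P → ∀ {x y} → P x → P y → x ≡ y
singleton-unique (_ , P⊆ , _) px py = trans (sym (P⊆ px)) (P⊆ py)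

singleton-⊆ : {P Q : Pred V 0ℓ} → P ⊆ Q → Singleton Q → ∀ {x} → P x → Singleton P
singleton-⊆ P⊆Q s {x} px = x , (λ py → singleton-unique s (P⊆Q px) (P⊆Q py)) , λ { refl → px }

module _ {S : Structure τ V} {a : Assignment V Γ} where

  members-unique : {Ys : Vec (RelTerm τ Γ 1) m} → Singletons S a Ys →
                   {u v : Vec V r} → Members S a Ys u → Members S a Ys v → u ≡ v
  members-unique s []       []       = refl
  members-unique s (x ∷ xs) (y ∷ ys) =
    cong₂ _∷_ (singleton-unique (s zero) x y) (members-unique (s ∘ suc) xs ys)

  members-exist : (Ys : Vec (RelTerm τ Γ 1) r) → Singletons S a Ys → Σ[ v ∈ Vec V r ] Members S a Ys v
  members-exist []       s = [] , []
  members-exist (Y ∷ Ys) s with s zero | members-exist Ys (s ∘ suc)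
  ... | x , _ , x∈ | v , vs = x ∷ v , x∈ refl ∷ vs

  -- Singletons have only one tuple of members, so checking that one tuple is enough.
  elem⁺ : ∀ {L} {Ys : Vec (RelTerm τ Γ 1) r} {Z} {v} → Singletons S a Ys → Members S a Ys v → ⟦ Z ⟧ S a v →
          _,_⊨_ {L = L} S a (elem Ys Z)
  elem⁺ {Z = Z} s vs z = lift (s , λ u us → subst (⟦ Z ⟧ S a) (members-unique s vs us) z)

infix 4 _≈ᵃ_

-- Relations are predicates, and a glued relation restricted to a part equals the piece chosen there
-- only up to mutual inclusion.
_≈ᵃ_ : Assignment V Γ → Assignment V Γ → Set
_≈ᵃ_ {Γ = Γ} a b = ∀ {r} (X : r VecMem.∈ Γ) → All.lookup a X ≐ All.lookup b X

≈ᵃ-∷ : {R R′ : Relation V r} {a b : Assignment V Γ} → R ≐ R′ → a ≈ᵃ b → (R ∷ a) ≈ᵃ (R′ ∷ b)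
≈ᵃ-∷ R≐ a≈b (here refl) = R≐
≈ᵃ-∷ R≐ a≈b (there X)   = a≈b X

module _ {S : Structure τ V} where

  ⟦⟧-cong : {a b : Assignment V Γ} → a ≈ᵃ b → (Z : RelTerm τ Γ r) → ⟦ Z ⟧ S a ≐ ⟦ Z ⟧ S b
  ⟦⟧-cong a≈b (con Z) = ≐-refl
  ⟦⟧-cong a≈b (var X) = a≈b X

  ⊨-cong : ∀ {L} {a b : Assignment V Γ} → a ≈ᵃ b → (Φ : Formula L τ Γ) → S , a ⊨ Φ → S , b ⊨ Φ
  ⊨-cong a≈b (empty X) (lift h) = lift λ x Xx → h x (proj₂ (⟦⟧-cong a≈b X) Xx)
  ⊨-cong a≈b (elem Ys Z) (lift (s , h)) = lift
    ( (λ j → let ⊆ , ⊇ = ⟦⟧-cong a≈b (Vec.lookup Ys j)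
                 x , X⊆ , ⊆X = s j in x , X⊆ ∘ ⊇ , ⊆ ∘ ⊆X)
    , λ v vs → proj₁ (⟦⟧-cong a≈b Z) (h v (Pointwise.map (λ {Y} → proj₂ (⟦⟧-cong a≈b Y)) vs)) )
  ⊨-cong a≈b (¬′ Φ) ¬h h = ¬h (⊨-cong (swap ∘ a≈b) Φ h)
  ⊨-cong a≈b (Φ ∧′ Ψ) (h , h′) = ⊨-cong a≈b Φ h , ⊨-cong a≈b Ψ h′
  ⊨-cong a≈b (∃′ r va Φ) (R , guarded , h) = R , guarded , ⊨-cong (≈ᵃ-∷ ≐-refl a≈b) Φ h

VarArity⇒nonzero : ∀ L → VarArity L r → 1 ≤ r
VarArity⇒nonzero MSO     refl    = s≤s z≤n
VarArity⇒nonzero (GSO m) (p , _) = p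

-- A partitioned structure with its assignment and all hypotheses on them. Carrier and index set are
-- fields, so that two unrelated decompositions can be compared.
record Decomposition (L : Logic) {w : ℕ} (B : Fin w ↣ Symbol τ 1) {k} (Γ : Vec ℕ k) : Set₁ where
  field
    {Carrier Index} : Set
    S               : Structure τ Carrier
    rooted          : Rooted B S
    F               : Index → Structure τ Carrier
    partition       : RootedPartition B S F
    guards          : GuardsRestrict L S F
    arities         : All (VarArity L) Γ
    a               : Assignment Carrier Γ
    guarded         : GuardedAssignment S a

  open RootedPartition partition public

  part : Index → Assignment Carrier Γ
  part i = All.map (_↾ F i) a

  part-guarded : ∀ i → GuardedAssignment (F i) (part i)
  part-guarded i X = subst (Guarded (F i)) (sym (lookup-map (_↾ F i) a X))
    (guards i (All.lookup arities X) (All.lookup a X) (guarded X))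

  -- The parts stay the same; the new assignment on part `i` is by computation `R ↾ F i` followed by
  -- the old one.
  adjoin : VarArity L r → (R : Relation Carrier r) → Guarded S R → Decomposition L B (r ∷ Γ)
  adjoin va R R-guarded = record
    { S = S ; rooted = rooted ; F = F ; partition = partition ; guards = guards
    ; arities = va ∷ arities ; a = R ∷ a
    ; guarded = λ { (here refl) → R-guarded ; (there X) → guarded X } }

  restrict : ∀ i (Z : RelTerm τ Γ r) → ⟦ Z ⟧ (F i) (part i) ≐ ⟦ Z ⟧ S a ↾ F i
  restrict i (con Z) = proj₂ (induced i) Z
  restrict i (var X) = subst (_≐ All.lookup a X ↾ F i) (sym (lookup-map (_↾ F i) a X)) ≐-refl

  members-restrict : ∀ i {Ys : Vec (RelTerm τ Γ 1) m} {v : Vec Carrier r} →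
                     Members S a Ys v → All (universe (F i)) v → Members (F i) (part i) Ys v
  members-restrict i []       []       = []
  members-restrict i {Y ∷ _} (x ∷ xs) (p ∷ ps) = proj₂ (restrict i Y) (x , p ∷ []) ∷ members-restrict i xs ps

  members-lift : ∀ i {Ys : Vec (RelTerm τ Γ 1) m} {v : Vec Carrier r} →
                 Members (F i) (part i) Ys v → Members S a Ys v
  members-lift i = Pointwise.map (λ {Y} x → proj₁ (proj₁ (restrict i Y) x))

-- Locating tuples in parts and gluing relations along the bag

module _ (em : ∀ ℓ → ExcludedMiddle ℓ) {L : Logic} {τ : Vocabulary} {w : ℕ} (B : Fin w ↣ Symbol τ 1) where

  open Types em L τ

  rootTerm : Fin w → RelTerm τ Γ 1
  rootTerm ℓ = con (Injection.to B ℓ)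

  Roots : Structure τ V → Vec (Fin w) m → Vec V r → Set
  Roots S = Pointwise (root B S)

  module _ {Γ : Vec ℕ k} (D : Decomposition L B Γ) where
    open Decomposition D

    overlap⊆bag : ∀ {i j} → i ≢ j → ∀ {x} → universe (F i) x → universe (F j) x → bag B S x
    overlap⊆bag i≢j p q = proj₁ (meet i≢j) (p , q)

    -- The covering provides some part with the element. If it is another part, the two meet in the
    -- whole bag; this also treats a partition into a single part.
    bag⊆part : ∀ i → bag B S ⊆ universe (F i)
    bag⊆part i {x} b@(ℓ , Bx) with proj₂ (proj₁ covers) (All.head (rel⊆ S (Injection.to B ℓ) Bx))
    ... | j , x∈j with decide em (i ≡ j)
    ...   | yes refl = x∈j
    ...   | no i≢j   = proj₁ (proj₂ (meet i≢j) b)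

    root-part : ∀ i {ℓ} → root B S ℓ ≐ root B (F i) ℓ
    root-part i {ℓ} = (λ Bx → proj₂ (proj₂ (induced i) (Injection.to B ℓ)) (Bx , bag⊆part i (ℓ , Bx) ∷ [])) ,
                      (λ Bx → proj₁ (proj₁ (proj₂ (induced i) (Injection.to B ℓ)) Bx))

    -- Adjacent elements share a part, and an element outside the bag has only
    -- one part; so the tuples of a guarded relation, being cliques of the
    -- Gaifman graph, do not cross parts.
    guarded⇒located : {R : Relation Carrier r} → 1 ≤ r → Guarded S R → ∀ {v} → R v → ∃[ i ] All (universe (F i)) v
    guarded⇒located _ (R⊆ , adjacent) {v} Rv with decide em (∃[ x ] (x VecMem.∈ v × ¬ bag B S x))
    ... | yes (x , x∈v , x∉bag) = i , lookup⁻ (λ j → nearby (∈-lookup j v))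
      where
      i = proj₁ (proj₂ (proj₁ covers) (All.lookup (R⊆ Rv) x∈v))
      x∈i : universe (F i) x
      x∈i = proj₂ (proj₂ (proj₁ covers) (All.lookup (R⊆ Rv) x∈v))
      nearby : ∀ {y} → y VecMem.∈ v → universe (F i) y
      nearby {y} y∈v with decide em (x ≡ y)
      ... | yes refl = x∈i
      ... | no x≢y with adjacent (x≢y , v , Rv , x∈v , y∈v)
      ...   | _ , Z , _ , u , Zu , x∈u , y∈u with proj₂ (proj₂ covers Z) Zu
      ...     | j , Zju with decide em (i ≡ j)
      ...       | yes refl = All.lookup (rel⊆ (F i) Z Zju) y∈u
      ...       | no i≢j   = ⊥-elim (x∉bag (overlap⊆bag i≢j x∈i (All.lookup (rel⊆ (F j) Z Zju) x∈u)))
    -- A tuple inside the bag lies in every part; its first element, present because the arity is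
    -- positive, shows that a part exists.
    guarded⇒located (s≤s _) (R⊆ , _) {x ∷ _} Rv | no ⊆bag with proj₂ (proj₁ covers) (All.head (R⊆ Rv))
    ... | i , _ = i , lookup⁻ (λ j → in-bag (∈-lookup j _))
      where
      in-bag : ∀ {y} → y VecMem.∈ _ → universe (F i) y
      in-bag {y} y∈v with decide em (bag B S y)
      ... | yes b = bag⊆part i b
      ... | no ∉b = ⊥-elim (⊆bag (y , y∈v , ∉b))

    located : (Z : RelTerm τ Γ r) → ∀ {v} → ⟦ Z ⟧ S a v → ∃[ i ] All (universe (F i)) v
    located (con Z) Zv with proj₂ (proj₂ covers Z) Zv
    ... | i , Ziv = i , rel⊆ (F i) Z Ziv
    located (var X) Rv = guarded⇒located (VarArity⇒nonzero L (All.lookup arities X)) (guarded X) Rv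

    part-singleton : ∀ i (Y : RelTerm τ Γ 1) → Singleton (asSet (⟦ Y ⟧ S a)) →
                     ∀ {x} → asSet (⟦ Y ⟧ S a) x → universe (F i) x → Singleton (asSet (⟦ Y ⟧ (F i) (part i)))
    part-singleton i Y s Yx x∈i =
      singleton-⊆ (proj₁ ∘ proj₁ (restrict i Y)) s (proj₂ (restrict i Y) (Yx , x∈i ∷ []))

    part-singletons : ∀ i {Ys : Vec (RelTerm τ Γ 1) r} {v : Vec Carrier r} → Singletons S a Ys →
                      Members S a Ys v → All (universe (F i)) v → Singletons (F i) (part i) Ys
    part-singletons i {Ys} s vs v⊆i j =
      part-singleton i (Vec.lookup Ys j) (s j) (Pointwise.lookup vs j) (lookup⁺ v⊆i j)

    rootTuple : (ℓs : Vec (Fin w) r) → Σ[ v ∈ Vec Carrier r ] Roots S ℓs v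
    rootTuple []       = [] , []
    rootTuple (ℓ ∷ ℓs) with rooted ℓ | rootTuple ℓs
    ... | x , _ , ⊆B | v , vs = x ∷ v , ⊆B refl ∷ vs

    roots⊆part : ∀ i {ℓs : Vec (Fin w) m} {v : Vec Carrier r} → Roots S ℓs v → All (universe (F i)) v
    roots⊆part i []       = []
    roots⊆part i (x ∷ xs) = bag⊆part i (_ , x) ∷ roots⊆part i xs

    bagTuple : {v : Vec Carrier r} → All (bag B S) v → Σ[ ℓs ∈ Vec (Fin w) r ] Roots S ℓs v
    bagTuple []             = [] , []
    bagTuple ((ℓ , x) ∷ xs) with bagTuple xs
    ... | ℓs , vs = ℓ ∷ ℓs , x ∷ vs

    -- Addresses a tuple of the bag by its root symbols. The formula has rank 0, so every colour
    -- records it, and it names corresponding tuples in different structures.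
    bagAtom : Vec (Fin w) r → Formula L τ (r ∷ Γ)
    bagAtom ℓs = elem (Vec.map rootTerm ℓs) (var (here refl))

    bagAtom⇔ : ∀ {ℓs : Vec (Fin w) r} {v : Vec Carrier r} → Roots S ℓs v →
               ∀ i {P : Relation Carrier r} {b : Assignment Carrier Γ} →
               (F i , (P ∷ b) ⊨ bagAtom ℓs) ⇔ P v
    bagAtom⇔ {ℓs = ℓs} vs i {P} {b} = mk⇔
      (λ { (lift (_ , h)) → h _ (members vs) })
      (elem⁺ {L = L} {Ys = Vec.map rootTerm ℓs} {Z = var (here refl)} (singletons ℓs) (members vs))
      where
      members : ∀ {m n} {ℓs : Vec (Fin w) m} {v : Vec Carrier n} → Roots S ℓs v →
                Members (F i) (P ∷ b) (Vec.map rootTerm ℓs) v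
      members []       = []
      members (x ∷ xs) = proj₁ (root-part i) x ∷ members xs
      singletons : ∀ {n} (ℓs : Vec (Fin w) n) → Singletons (F i) (P ∷ b) (Vec.map rootTerm ℓs)
      singletons (ℓ ∷ ℓs) zero    =
        let x , B⊆ , ⊆B = rooted ℓ in x , B⊆ ∘ proj₂ (root-part i) , proj₁ (root-part i) ∘ ⊆B
      singletons (ℓ ∷ ℓs) (suc j) = singletons ℓs j

    module _ {P : Index → Relation Carrier r} (P-guarded : ∀ i → Guarded (F i) (P i)) where

      ⋃-guarded : Guarded S (⋃ Index P)
      ⋃-guarded = (λ (i , Pv) → All.map (proj₁ (induced i)) (proj₁ (P-guarded i) Pv)) ,
        λ (x≢y , v , (i , Pv) , x∈ , y∈) → case proj₂ (P-guarded i) (x≢y , v , Pv , x∈ , y∈) of λ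
          (r , Z , x≢y , u , Zu , x∈u , y∈u) → r , Z , x≢y , u , proj₁ (proj₁ (proj₂ (induced i) Z) Zu) , x∈u , y∈u

      -- A tuple from another piece that lies in `F i` lies in two parts, hence in the bag, where
      -- the pieces agree.
      ⋃-restrict : (∀ {i j} {ℓs : Vec (Fin w) r} {v : Vec Carrier r} → Roots S ℓs v → P j v → P i v) →
                   ∀ i → ⋃ Index P ↾ F i ≐ P i
      ⋃-restrict agree i = (λ ((j , Pv) , v⊆i) → inside j Pv v⊆i) , λ Pv → (i , Pv) , proj₁ (P-guarded i) Pv
        where
        inside : ∀ j {v} → P j v → All (universe (F i)) v → P i v
        inside j Pv v⊆i with decide em (i ≡ j)
        ... | yes refl = Pv
        ... | no i≢j   = agree (proj₂ (bagTuple (All.map (λ (p , q) → overlap⊆bag i≢j p q)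
                                                   (All.zip (v⊆i , proj₁ (P-guarded j) Pv))))) Pv

  Models : Decomposition L B Γ → Formula L τ Γ → Set₁
  Models D Φ = Decomposition.S D , Decomposition.a D ⊨ Φ

  colours : ∀ q (D : Decomposition L B Γ) → Decomposition.Index D → Colour Γ q
  colours q D i = colour q (F i) (part i)
    where open Decomposition D

  colour-cong : ∀ {S : Structure τ V} {a b : Assignment V Γ} → a ≈ᵃ b → colour q S a ≡ colour q S b
  colour-cong a≈b = type⇒colour ((λ {Φ} → map₂ (⊨-cong a≈b Φ)) , λ {Φ} → map₂ (⊨-cong (swap ∘ a≈b) Φ))

  -- Transfer of truth between decompositions with similar counts

  module _ {Γ : Vec ℕ k} (D D′ : Decomposition L B Γ) where
    private
      module D  = Decomposition D
      module D′ = Decomposition D′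

    -- An element of `X` would lie in a part of `D′` whose colour recurs in `D`, and there `X` is
    -- empty on the matching part.
    transfer-empty : ∀ X → Similar 1 (colours q D) (colours q D′) → Models D (empty X) → Models D′ (empty X)
    transfer-empty {q = q} X s (lift h) = lift absurd
      where
      absurd : ∀ x → ¬ asSet (⟦ X ⟧ D′.S D′.a) x
      absurd x Xx with located D′ X Xx
      ... | i′ , x∈i′ with similar⇒match s i′
      ...   | i , same = lower (colour⇒⊨ {q = q} same (empty X) z≤n
                (lift λ y Xy → h y (proj₁ (proj₁ (D.restrict i X) Xy))))
                x (proj₂ (D′.restrict i′ X) (Xx , x∈i′))

    -- A part of `D` containing the element has a match in `D′`, which gives existence. If two parts
    -- of `D′` meet `Y`, they have distinct matches in `D`, both containing `y`; so `y` is a root,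
    -- and the elements in `D′` are the same root.
    transfer-singleton : ∀ Y → Similar 2 (colours q D) (colours q D′) →
                         Singleton (asSet (⟦ Y ⟧ D.S D.a)) → Singleton (asSet (⟦ Y ⟧ D′.S D′.a))
    transfer-singleton {q = q} Y s single@(y , Y⊆y , y⊆Y) with located D Y (y⊆Y refl)
    ... | i₀ , y∈i₀ ∷ [] with similar⇒match (similar-sym s) i₀
    -- The atom `elem (Y ∷ []) Y` says just that `Y` is a singleton.
    ...   | j₀ , same₀ with proj₁ (lower (colour⇒⊨ {q = q} (sym same₀) (elem (Y ∷ []) Y) z≤n
                              (elem⁺ {L = L} {Z = Y} (λ { zero → part-singleton D i₀ Y single (y⊆Y refl) y∈i₀ })
                                     (here′ ∷ []) here′))) zero
      where
      here′ : asSet (⟦ Y ⟧ (D.F i₀) (D.part i₀)) y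
      here′ = proj₂ (D.restrict i₀ Y) (y⊆Y refl , y∈i₀ ∷ [])
    ...     | y′ , Y⊆y′ , y′⊆Y = y′ , only , λ { refl → proj₁ (proj₁ (D′.restrict j₀ Y) (y′⊆Y refl)) }
      where
      -- If the match in `D′` meets `Y`, then so does the part of `D`, and `y` is the only element
      -- it can contain.
      witness : ∀ {i j z} → colours q D i ≡ colours q D′ j → asSet (⟦ Y ⟧ (D′.F j) (D′.part j)) z →
                universe (D.F i) y
      witness {i} {j} {z} same Yz with decide em (universe (D.F i) y)
      ... | yes y∈i = y∈i
      ... | no y∉i  = ⊥-elim (lower (colour⇒⊨ {q = q} same (empty Y) z≤n
                        (lift λ x Yx → case proj₁ (D.restrict i Y) Yx of λ
                          { (Yx , x∈i ∷ []) → y∉i (subst (universe (D.F i)) (sym (Y⊆y Yx)) x∈i) }))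
                        z Yz)
      in-root : ∀ {i j z} ℓ → root B D.S ℓ y → colours q D i ≡ colours q D′ j →
                asSet (⟦ Y ⟧ (D′.F j) (D′.part j)) z → root B D′.S ℓ z
      in-root {i} {j} {z} ℓ By same Yz = proj₂ (root-part D′ j)
        (proj₂ (lower (colour⇒⊨ {q = q} same (elem (Y ∷ []) (rootTerm ℓ)) z≤n
          (elem⁺ {L = L} {Z = rootTerm ℓ} (λ { zero → part-singleton D i Y single (y⊆Y refl) y∈i })
                 (proj₂ (D.restrict i Y) (y⊆Y refl , y∈i ∷ []) ∷ []) (proj₁ (root-part D i) By))))
          (z ∷ []) (Yz ∷ []))
        where y∈i = witness same Yz
      only : asSet (⟦ Y ⟧ D′.S D′.a) ⊆ ｛ y′ ｝
      only {z} Yz with located D′ Y Yz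
      ... | j , z∈j ∷ [] with decide em (j₀ ≡ j)
      ...   | yes refl = Y⊆y′ (proj₂ (D′.restrict j Y) (Yz , z∈j ∷ []))
      -- This is where threshold 2 is needed: the two matches must be different parts to force `y`
      -- into the bag.
      ...   | no j₀≢j with similar⇒match₂ em s j₀≢j
      ...     | i₁ , i₂ , i₁≢i₂ , same₁ , same₂ with
                  overlap⊆bag D i₁≢i₂ (witness same₁ (y′⊆Y refl))
                                      (witness same₂ (proj₂ (D′.restrict j Y) (Yz , z∈j ∷ [])))
      ...       | ℓ , By = singleton-unique (D′.rooted ℓ) (in-root ℓ By same₁ (y′⊆Y refl))
                             (in-root ℓ By same₂ (proj₂ (D′.restrict j Y) (Yz , z∈j ∷ [])))

    -- The unique tuple of members lies within one part, and a matching part satisfies the same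
    -- atom. That no other part adds members is the content of `transfer-singleton`.
    transfer-elem : (Ys : Vec (RelTerm τ Γ 1) r) (Z : RelTerm τ Γ r) → Similar 2 (colours q D) (colours q D′) →
                    Models D (elem Ys Z) → Models D′ (elem Ys Z)
    transfer-elem {q = q} Ys Z s (lift (single , h)) with members-exist Ys single
    ... | v , vs with located D Z (h v vs)
    ...   | i , v⊆i with similar⇒match (similar-sym s) i
    ...     | j , same with colour⇒⊨ {q = q} (sym same) (elem Ys Z) z≤n
                              (elem⁺ {L = L} {Z = Z} (part-singletons D i single vs v⊆i)
                                     (D.members-restrict i vs v⊆i)
                                     (proj₂ (D.restrict i Z) (h v vs , v⊆i)))
    ...       | lift (single′ , h′) with members-exist Ys single′
    ...         | u , us = elem⁺ {L = L} {Z = Z} (λ l → transfer-singleton {q = q} (Vec.lookup Ys l) s (single l))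
                             (D′.members-lift j us) (proj₁ (proj₁ (D′.restrict j Z) (h′ u us)))

    -- On each part of `D′` the back-and-forth property copies the restriction of `R` to its
    -- partner; the union of the copies is the new relation.
    adjoin-matching : (va : VarArity L r) → Sentence (r ∷ Γ) q → ∀ {R} (R-guarded : Guarded D.S R) →
      (p : D′.Index → D.Index) → (∀ j → colours (suc q) D (p j) ≡ colours (suc q) D′ j) →
      Σ[ R′ ∈ Relation D′.Carrier r ] Σ[ R′-guarded ∈ Guarded D′.S R′ ]
        (∀ j → colours q (D′.adjoin va R′ R′-guarded) j ≡ colours q (D.adjoin va R R-guarded) (p j))
    adjoin-matching {r = r} {q = q} va φ {R} R-guarded p same =
      ⋃ D′.Index P , ⋃-guarded D′ P-guarded , λ j →
        trans (colour-cong (≈ᵃ-∷ (⋃-restrict D′ P-guarded agree j) (λ _ → ≐-refl))) (sym (P-same j))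
      where
      piece : ∀ j → Σ[ P ∈ Relation D′.Carrier r ] (Guarded (D′.F j) P ×
                colour q (D.F (p j)) ((R ↾ D.F (p j)) ∷ D.part (p j)) ≡ colour q (D′.F j) (P ∷ D′.part j))
      piece j = extend (same j) va φ (R ↾ D.F (p j)) (D.guards (p j) va R R-guarded)
      P : D′.Index → Relation D′.Carrier r
      P j = proj₁ (piece j)
      P-guarded : ∀ j → Guarded (D′.F j) (P j)
      P-guarded j = proj₁ (proj₂ (piece j))
      P-same : ∀ j → colour q (D.F (p j)) ((R ↾ D.F (p j)) ∷ D.part (p j)) ≡ colour q (D′.F j) (P j ∷ D′.part j)
      P-same j = proj₂ (proj₂ (piece j))
      -- Membership of a bag tuple is passed from part `j` to its partner in `D`, where it concerns
      -- the single relation `R`, and from there to part `i`.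
      agree : ∀ {i j} {ℓs : Vec (Fin w) r} {v : Vec D′.Carrier r} → Roots D′.S ℓs v → P j v → P i v
      agree {i} {j} {ℓs} {v} vs Pv = Equivalence.to (bagAtom⇔ D′ vs i)
          (colour⇒⊨ {q = q} (P-same i) (bagAtom D ℓs) z≤n
            (Equivalence.from (bagAtom⇔ D us (p i)) (Ru , roots⊆part D (p i) us)))
        where
        u : Vec D.Carrier r
        u = proj₁ (rootTuple D ℓs)
        us : Roots D.S ℓs u
        us = proj₂ (rootTuple D ℓs)
        Ru : R u
        Ru = proj₁ (Equivalence.to (bagAtom⇔ D us (p j))
               (colour⇒⊨ {q = q} (sym (P-same j)) (bagAtom D ℓs) z≤n (Equivalence.from (bagAtom⇔ D′ vs j) Pv)))

    transfer-∃ : ∀ N (va : VarArity L r) (φ@(Φ , _) : Sentence (r ∷ Γ) q) →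
                 (∀ E E′ → Similar N (colours q E) (colours q E′) → Models E Φ → Models E′ Φ) →
                 Similar (suc (length (proj₁ (listable-Colour (r ∷ Γ) q)) * suc N))
                         (colours (suc q) D) (colours (suc q) D′) →
                 Models D (∃′ r va Φ) → Models D′ (∃′ r va Φ)
    transfer-∃ {r = r} {q = q} N va φ transferΦ s (R , R-guarded , h)
      -- The threshold `suc N` instead of `N` ensures that every part of `D′` has a partner with the
      -- same pair of colours, even for `N = 0`.
      with refine em (listable⇒↣ (listable-Colour (r ∷ Γ) q)) (suc N) s (colours q (D.adjoin va R R-guarded))
    ... | c′ , s′ with adjoin-matching {q = q} va φ R-guarded (proj₁ ∘ similar⇒match s′)
                         (cong proj₁ ∘ proj₂ ∘ similar⇒match s′)
    ...   | R′ , R′-guarded , same = R′ , R′-guarded ,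
            transferΦ (D.adjoin va R R-guarded) (D′.adjoin va R′ R′-guarded)
              (similar-resp-≗ (λ j → trans (same j) (cong proj₂ (proj₂ (similar⇒match s′ j))))
                (similar-mono (n≤1+n N) (similar-∘ em proj₂ s′))) h

  -- The threshold is chosen before the decompositions, so the negation case may swap them.
  transfer : ∀ q (Φ : Formula L τ Γ) → rank Φ ≤ q → ∃[ N ] (∀ (D D′ : Decomposition L B Γ) →
             Similar N (colours q D) (colours q D′) → Models D Φ → Models D′ Φ)
  transfer q (empty X) _ = 1 , λ D D′ → transfer-empty D D′ {q = q} X
  transfer q (elem Ys Z) _ = 2 , λ D D′ → transfer-elem D D′ {q = q} Ys Z
  transfer q (¬′ Φ) Φ≤q with transfer q Φ Φ≤q
  ... | N , t = N , λ D D′ s ¬h h → ¬h (t D′ D (similar-sym s) h)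
  transfer q (Φ ∧′ Ψ) ≤q with transfer q Φ (m⊔n≤o⇒m≤o _ _ ≤q) | transfer q Ψ (m⊔n≤o⇒n≤o _ _ ≤q)
  ... | M , t | N , u = M ⊔ N , λ D D′ s (h , h′) →
    t D D′ (similar-mono (m≤m⊔n M N) s) h , u D D′ (similar-mono (m≤n⊔m M N) s) h′
  transfer (suc q) (∃′ r va Φ) (s≤s Φ≤q) with transfer q Φ Φ≤q
  ... | N , t = _ , λ D D′ → transfer-∃ D D′ {q = q} N va (Φ , Φ≤q) t

-- Threshold counting in first-order logic

module _ {p} {P : Set p} where

  falseᶠ : ∀ {n} → FO P n
  falseᶠ = ∃′ (¬′ (zero ≐′ zero))

  ⋀ᶠ : ∀ {m n} → (Fin m → FO P n) → FO P n
  ⋀ᶠ {zero}  α = ¬′ falseᶠ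
  ⋀ᶠ {suc m} α = α zero ∧′ ⋀ᶠ (α ∘ suc)

  -- Each new element must differ from everything in the environment, which holds the elements
  -- chosen so far; `χ` is given for every number of variables because it is used under quantifiers.
  atLeast : ∀ {n} → (∀ {n} → Fin n → FO P n) → ℕ → FO P n
  atLeast χ zero    = ¬′ falseᶠ
  atLeast χ (suc m) = ∃′ (χ zero ∧′ ⋀ᶠ (λ j → ¬′ (zero ≐′ suc j)) ∧′ atLeast χ m)

  module _ {I : Set} (M : MonadicStructure P I) where

    ⊭falseᶠ : ∀ {n} {e : Vec I n} → ¬ (M , e ⊨ᶠ falseᶠ)
    ⊭falseᶠ (_ , i≢i) = i≢i (lift refl)

    ⋀ᶠ⁺ : ∀ {m n} {e : Vec I n} (α : Fin m → FO P n) → (∀ j → M , e ⊨ᶠ α j) → M , e ⊨ᶠ ⋀ᶠ α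
    ⋀ᶠ⁺ {zero}  {e = e} α h = ⊭falseᶠ {e = e}
    ⋀ᶠ⁺ {suc m} α h = h zero , ⋀ᶠ⁺ (α ∘ suc) (h ∘ suc)

    ⋀ᶠ⁻ : ∀ {m n} {e : Vec I n} (α : Fin m → FO P n) → M , e ⊨ᶠ ⋀ᶠ α → ∀ j → M , e ⊨ᶠ α j
    ⋀ᶠ⁻ α (h , hs) zero    = h
    ⋀ᶠ⁻ α (h , hs) (suc j) = ⋀ᶠ⁻ (α ∘ suc) hs j

    module _ {C : Set} (c : I → C) (v : C) (χ : ∀ {n} → Fin n → FO P n)
             (χ⇔ : ∀ {n} (e : Vec I n) x → (M , e ⊨ᶠ χ x) ⇔ (c (Vec.lookup e x) ≡ v)) where

      Avoiding : ∀ {m n} → (Fin m → I) → Vec I n → Set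
      Avoiding f e = ∀ i j → f i ≢ Vec.lookup e j

      -- Avoidance of the environment is carried along in the induction: it makes the extended map
      -- injective.
      atLeast⁻ : ∀ m {n} (e : Vec I n) → M , e ⊨ᶠ atLeast χ m →
                 Σ[ f ∈ Fin m ↣ Fibre c v ] Avoiding (proj₁ ∘ Injection.to f) e
      atLeast⁻ zero    e _ = mk↣ {to = λ ()} (λ { {()} }) , λ ()
      atLeast⁻ (suc m) e (i , hχ , fresh , h) with atLeast⁻ m (i ∷ e) h
      ... | f , f∌e = mk↣ {to = g} g-injective , g∌e
        where
        g : Fin (suc m) → Fibre c v
        g zero    = i , Equivalence.to (χ⇔ (i ∷ e) zero) hχ
        g (suc j) = Injection.to f j
        g-injective : ∀ {j k} → g j ≡ g k → j ≡ k
        g-injective {zero}  {zero}  _  = refl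
        g-injective {zero}  {suc k} eq = ⊥-elim (f∌e k zero (sym (cong proj₁ eq)))
        g-injective {suc j} {zero}  eq = ⊥-elim (f∌e j zero (cong proj₁ eq))
        g-injective {suc j} {suc k} eq = cong suc (Injection.injective f eq)
        g∌e : Avoiding (proj₁ ∘ g) e
        g∌e zero    k eq = ⋀ᶠ⁻ (λ j → ¬′ (zero ≐′ suc j)) fresh k (lift eq)
        g∌e (suc j) k eq = f∌e j (suc k) eq

      atLeast⁺ : ∀ m {n} (e : Vec I n) (f : Fin m ↣ Fibre c v) → Avoiding (proj₁ ∘ Injection.to f) e →
                 M , e ⊨ᶠ atLeast χ m
      atLeast⁺ zero    e f f∌e = ⊭falseᶠ {e = e}
      atLeast⁺ (suc m) e f f∌e = i , Equivalence.from (χ⇔ (i ∷ e) zero) (proj₂ (Injection.to f zero)) ,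
          ⋀ᶠ⁺ (λ j → ¬′ (zero ≐′ suc j)) (λ j → f∌e zero j ∘ lower) ,
          atLeast⁺ m (i ∷ e) (f ↣-∘ mk↣ suc-injective) later
        where
        i = proj₁ (Injection.to f zero)
        later : Avoiding (proj₁ ∘ Injection.to f ∘ suc) (i ∷ e)
        later j (suc k) eq = f∌e (suc j) k eq
        later j zero    eq = case Injection.injective f (fibre-≡ eq) of λ ()

      atLeast⇔ : ∀ m → (M ⊨ᶠ atLeast χ m) ⇔ (Fin m ↣ Fibre c v)
      atLeast⇔ m = mk⇔ (proj₁ ∘ atLeast⁻ m []) (λ f → atLeast⁺ m [] f λ i ())

-- First-order definability of similarity-invariant properties

module _ (em : ∀ ℓ → ExcludedMiddle ℓ) {L : Logic} {τ : Vocabulary} {w : ℕ} (B : Fin w ↣ Symbol τ 1)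
         {k} {Γ : Vec ℕ k} (q : ℕ) where

  open Types em L τ
  open BooleanCombination em {F = FO (Type L τ Γ q) 0} ¬′_ _∧′_ falseᶠ

  typeColour : Type L τ Γ q → Colour Γ q
  typeColour T = let _ , S , a , _ = realised T in colour q S a

  -- Any realised type of the given colour serves, since types of equal colour contain the same
  -- formulas. A colour realised by no type occurs on no part, hence the false formula.
  hasColour : Colour Γ q → ∀ {n} → Fin n → FO (Type L τ Γ q) n
  hasColour v x with decide em (∃[ T ] typeColour T ≡ v)
  ... | yes (T , _) = pred T x
  ... | no _        = falseᶠ

  indicatorOf : (D : Decomposition L B Γ) → MonadicStructure (Type L τ Γ q) (Decomposition.Index D)
  indicatorOf D = indicator L q F a
    where open Decomposition D

  module _ (D : Decomposition L B Γ) where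
    open Decomposition D

    partType : Index → Type L τ Γ q
    partType i = record { realised = Carrier , F i , part i , part-guarded i , ≐-refl }

    indicator⇔colour : ∀ T i → indicatorOf D T i ⇔ (colours em B q D i ≡ typeColour T)
    indicator⇔colour T i with realised T
    ... | _ , S , a , _ , eq = mk⇔
      (λ h → type⇒colour (≐-trans (≐-sym h) eq))
      (λ same → ≐-trans eq (≐-sym (colour⇒type same)))

    hasColour⇔ : ∀ v {n} (e : Vec Index n) x →
                 (indicatorOf D , e ⊨ᶠ hasColour v x) ⇔ (colours em B q D (Vec.lookup e x) ≡ v)
    hasColour⇔ v e x with decide em (∃[ T ] typeColour T ≡ v)
    ... | yes (T , refl) = indicator⇔colour T (Vec.lookup e x)
    ... | no unrealised  = mk⇔ (λ h → ⊥-elim (⊭falseᶠ (indicatorOf D) {e = e} h))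
                               (λ same → ⊥-elim (unrealised (partType (Vec.lookup e x) , same)))

  countings : ℕ → List (FO (Type L τ Γ q) 0)
  countings N = cartesianProductWith (λ v m → atLeast (hasColour v) m) (proj₁ (listable-Colour Γ q)) (upTo (suc N))

  profile : (N : ℕ) → Decomposition L B Γ → Vec Bool (length (countings N))
  profile N D = truth em (indicatorOf D ⊨ᶠ_) (countings N)

  -- The counting sentences test every size up to `N`. If both classes have at most `N` elements,
  -- each size is itself a tested bound, and the two inequalities give equality.
  profile⇒similar : ∀ N D D′ → profile N D ≡ profile N D′ → Similar N (colours em B q D) (colours em B q D′)
  profile⇒similar N D D′ same v = compare (atLeast⊎finite em N (Fib D)) (atLeast⊎finite em N (Fib D′))
    where
    Fib : Decomposition L B Γ → Set
    Fib D = Fibre (colours em B q D) v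
    transport : ∀ {m} D D′ → profile N D ≡ profile N D′ → m ≤ N → Fin m ↣ Fib D → Fin m ↣ Fib D′
    transport {m} D D′ same m≤N f =
      Equivalence.to (atLeast⇔ (indicatorOf D′) (colours em B q D′) v (hasColour v) (hasColour⇔ D′ v) m)
        (truth-≡ em {T = indicatorOf D ⊨ᶠ_} {U = indicatorOf D′ ⊨ᶠ_} same
          (∈-cartesianProductWith⁺ (λ v m → atLeast (hasColour v) m)
            (proj₂ (listable-Colour Γ q) v) (∈-upTo⁺ (s≤s m≤N)))
          (Equivalence.from (atLeast⇔ (indicatorOf D) (colours em B q D) v (hasColour v) (hasColour⇔ D v) m) f))
    bound : ∀ {m n} D D′ → profile N D ≡ profile N D′ → m ≤ N → Fib D ↔ Fin m → Fib D′ ↔ Fin n → m ≤ n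
    bound D D′ same m≤N b b′ =
      injective⇒≤ (Injection.injective (↔⇒↣ b′ ↣-∘ transport D D′ same m≤N (↔⇒↣ (↔-sym b))))
    compare : (Fin N ↣ Fib D) ⊎ (∃[ m ] (m ≤ N × (Fib D ↔ Fin m))) →
              (Fin N ↣ Fib D′) ⊎ (∃[ m ] (m ≤ N × (Fib D′ ↔ Fin m))) → Alike N (Fib D) (Fib D′)
    compare (inj₁ f) _ = inj₂ (f , transport D D′ same ≤-refl f)
    compare (inj₂ _) (inj₁ g) = inj₂ (transport D′ D (sym same) ≤-refl g , g)
    compare (inj₂ (m , m≤N , b)) (inj₂ (n , n≤N , b′))
      with ≤-antisym (bound D D′ same m≤N b b′) (bound D′ D (sym same) n≤N b′ b)
    ... | refl = inj₁ (↔-sym b′ ↔-∘ b)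

  -- A profile is good if some decomposition with property `Q` has it. By invariance all
  -- decompositions with that profile then satisfy `Q`, so a Boolean combination of counting
  -- sentences defines it.
  similarity-invariant⇒definable : ∀ N (Q : Decomposition L B Γ → Set₁) →
    (∀ D D′ → Similar N (colours em B q D) (colours em B q D′) → Q D → Q D′) →
    Σ[ α ∈ FO (Type L τ Γ q) 0 ] (∀ D → (indicatorOf D ⊨ᶠ α) ⇔ Q D)
  similarity-invariant⇒definable N Q invariant = combination (countings N) Good , λ D →
      let α⇔ = T-combination (valuation D) (countings N) Good in
      mk⇔ (λ h → let D′ , same , Q-D′ = Equivalence.to α⇔ h in invariant D′ D (profile⇒similar N D′ D same) Q-D′)
          (λ Q-D → Equivalence.from α⇔ (D , refl , Q-D))
    where
    Good : Vec Bool (length (countings N)) → Set₁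
    Good u = Σ[ D ∈ Decomposition L B Γ ] (profile N D ≡ u × Q D)
    valuation : ∀ D → Valuation (indicatorOf D ⊨ᶠ_)
    valuation D = record { not⇔ = ⇔-id _ ; and⇔ = ⇔-id _ }

theorem14 : (∀ ℓ → ExcludedMiddle ℓ) →
    (L : Logic) (τ : Vocabulary) (k q : ℕ) (Γ : Vec ℕ k) → All (VarArity L) Γ →
    (Φ : Formula L τ Γ) → rank Φ ≤ q →
    (w : ℕ) (B : Fin w ↣ Symbol τ 1) →
    Σ[ α ∈ FO (Type L τ Γ q) 0 ]
    ((V : Set) (S : Structure τ V) → Rooted B S →
    (I : Set) (F : I → Structure τ V) → RootedPartition B S F → GuardsRestrict L S F →
    (a : Assignment V Γ) → GuardedAssignment S a →
    (indicator L q F a ⊨ᶠ α) ⇔ (S , a ⊨ Φ))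
theorem14 em L τ k q Γ arities Φ Φ≤q w B with transfer em B q Φ Φ≤q
... | N , invariant with similarity-invariant⇒definable em B q N (λ D → Models em B D Φ) invariant
...   | α , α⇔ = α , λ V S rooted I F partition guards a guarded → α⇔ (record
          { S = S ; rooted = rooted ; F = F ; partition = partition ; guards = guards
          ; arities = arities ; a = a ; guarded = guarded })
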